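{- Let $G=(V,E)$ be a semi-circular cubic ($3$-regular) simple graph with $n=|V|$ vertices, and let $n_1=|V_1|$ and $n_0=|V_0|$ be the number of vertices of $G$ lying in the closed disk bounded by the first circle $O_1$ and in the interior of that disk, respectively. If $G$ has no $3$-cycles and no $4$-cycles, then the number $\operatorname{perfmat} G$ of perfect matchings of $G$ satisfies $$\operatorname{perfmat} G\le 20^{\frac{n-n_1}{12}}\,3^{\frac{n_1}{4}}\quad\text{if } n_0>0,$$ $$\operatorname{perfmat} G\le 20^{\frac n{12}}\quad\text{if } G \text{ is circular, i.e. } n_0=0.$$
   Context: A connected planar graph $G=(V,E)$ is semi-circular if it can be drawn in the plane as follows. There are $k\ge1$ circles $O_1,\dots,O_k$ centered at the origin, of radii $0<r_1<\dots<r_k$. On the circle $O_j$ there are $m_j\ge3$ vertices, forming a set $U_j\subset V$, and the subgraph $G(U_j)$ of $G$ induced on $U_j$ is the cycle $C_{m_j}$ whose edges are the arcs of $O_j$ between consecutive vertices. For $i=1,\dots,k-1$ some vertices of $U_i$ are joined to some vertices of $U_{i+1}$ by edges lying in the annulus $r_i\le\sqrt{x^2+y^2}\le r_{i+1}$ which do not intersect in the interior of the annulus (at least one such edge exists for each $i$, as $G$ is connected). The remaining vertices form a set $V_0$ lying in the open disk of radius $r_1$ about the origin, and the subgraph $G(U_1\cup V_0)$ induced on $U_1\cup V_0$ is a connected planar graph whose vertices and edges lie in the closed disk of radius $r_1$. $G$ has no other vertices or edges. Set $V_i=V_0\cup U_1\cup\dots\cup U_i$, so $V_k=V$. $G$ (with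 such a drawing) is circular if $V_0=\emptyset$. -}

module Defs where

open import Data.Fin using (Fin; _<?_)
open import Data.Fin.Properties using (_≟_; all?)
open import Data.List using (List; []; _∷_; _++_; map; filter; length; allFin; cartesianProduct)
open import Data.Nat using (ℕ; suc; _+_; _≤_; _<_; _≤?_)
open import Data.Nat.GeneralisedArithmetic using (iterate)
open import Data.Nat.Properties using () renaming (_≟_ to _≟ℕ_)
open import Data.Product using (_×_; _,_; ∃; proj₁; proj₂)
open import Data.Sum using (_⊎_)
open import Data.Unit using (⊤)
open import Function.Bundles using (_⇔_)
open import Level using (0ℓ)
open import Relation.Binary using (Rel; Irreflexive; Symmetric) renaming (Decidable to Decidable₂)
open import Relation.Binary.Construct.Closure.ReflexiveTransitive using (Star)
open import Relation.Binary.PropositionalEquality using (_≡_; _≢_)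
open import Relation.Nullary using (¬_)
open import Relation.Nullary.Decidable using (_×-dec_; _⊎-dec_)
open import Relation.Unary using (Pred; Decidable)

record SimpleGraph (n : ℕ) : Set₁ where
  infix 4 _~_ _~?_
  field
    _~_    : Rel (Fin n) 0ℓ
    _~?_   : Decidable₂ _~_
    irrefl : Irreflexive _≡_ _~_
    sym    : Symmetric _~_

open SimpleGraph public using () renaming (_~_ to Adj; _~?_ to adj?)

count : ∀ {n} {P : Pred (Fin n) 0ℓ} → Decidable P → ℕ
count {n} P? = length (filter P? (allFin n))

module _ {n : ℕ} (G : SimpleGraph n) where

  degree : Fin n → ℕ
  degree v = count (adj? G v)

  Cubic : Set
  Cubic = ∀ v → degree v ≡ 3

  No3Cycles : Set
  No3Cycles = ∀ a b c → ¬ (Adj G a b × Adj G b c × Adj G c a)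

  No4Cycles : Set
  No4Cycles = ∀ a b c d → a ≢ c → b ≢ d →
              ¬ (Adj G a b × Adj G b c × Adj G c d × Adj G d a)

  -- Connectedness of the subgraph induced on the vertices satisfying P.
  ConnectedOn : Pred (Fin n) 0ℓ → Set
  ConnectedOn P = ∀ u v → P u → P v →
                  Star (λ x y → P x × P y × Adj G x y) u v

  Connected : Set
  Connected = ConnectedOn (λ _ → ⊤)

  -- Each edge {u , v} is listed once, as the pair (u , v) with u < v.
  edges : List (Fin n × Fin n)
  edges = filter (λ e → (proj₁ e <? proj₂ e) ×-dec adj? G (proj₁ e) (proj₂ e))
                 (cartesianProduct (allFin n) (allFin n))

-- For xs without repetitions, each subset of the entries is listed exactly once.
sublists : ∀ {A : Set} → List A → List (List A)
sublists []       = [] ∷ []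
sublists (x ∷ xs) = sublists xs ++ map (x ∷_) (sublists xs)

module _ {n : ℕ} where

  Incident : Fin n → Fin n × Fin n → Set
  Incident v (a , b) = v ≡ a ⊎ v ≡ b

  incident? : ∀ v → Decidable (Incident v)
  incident? v (a , b) = (v ≟ a) ⊎-dec (v ≟ b)

  CoversOnce : List (Fin n × Fin n) → Set
  CoversOnce M = ∀ v → length (filter (incident? v) M) ≡ 1

  coversOnce? : Decidable CoversOnce
  coversOnce? M = all? (λ v → length (filter (incident? v) M) ≟ℕ 1)

-- The number of perfect matchings, i.e. of sets of edges that cover every
-- vertex exactly once.
perfmat : ∀ {n} → SimpleGraph n → ℕ
perfmat G = length (filter coversOnce? (sublists (edges G)))

-- f restricts to a cyclic permutation of the finite set P: since some iterate
-- of f leads from any element of P to any other, f is onto P, hence bijective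
-- on P, and P is a single orbit.
CyclicOn : ∀ {A : Set} → Pred A 0ℓ → (A → A) → Set
CyclicOn P f = (∀ x → P x → P (f x)) ×
               (∀ x y → P x → P y → ∃ λ i → iterate f x i ≡ y)

-- A drawing of a connected graph in the oriented sphere, up to homeomorphism,
-- given by its rotation system.  `rot v w` is the neighbour of v that follows
-- the neighbour w in the counterclockwise order around v (its value is
-- irrelevant when w is not a neighbour of v).
record SphericalDrawing {n : ℕ} (G : SimpleGraph n) : Set where
  field
    rot      : Fin n → Fin n → Fin n
    rotation : ∀ v → CyclicOn (Adj G v) (rot v)

  Dart : Pred (Fin n × Fin n) 0ℓ
  Dart (u , v) = Adj G u v

  -- Walking along the boundary of the face on the right-hand side of a dart.
  faceStep : Fin n × Fin n → Fin n × Fin n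
  faceStep (u , v) = v , rot v u

  -- The faces are the orbits of faceStep on the darts, numbered by Fin #faces;
  -- `face` is irrelevant on pairs that are not darts.
  field
    #faces    : ℕ
    face      : Fin n × Fin n → Fin #faces
    face-onto : ∀ f → ∃ λ d → Dart d × face d ≡ f
    face-orbit : ∀ d e → Dart d → Dart e →
                 (face d ≡ face e) ⇔ (∃ λ i → iterate faceStep d i ≡ e)
    -- Euler's formula: for connected G, the surface is the sphere.
    euler     : n + #faces ≡ length (edges G) + 2

-- A connected graph with a semi-circular drawing, up to homeomorphism of the
-- plane.  The vertices of layer j ≥ 1 are those of U_j, on the circle O_j; the
-- vertices of layer 0 are those of V_0.
record SemiCircular {n : ℕ} (G : SimpleGraph n) : Set where
  field
    connected : Connected G
    k         : ℕ
    k≥1       : 1 ≤ k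
    layer     : Fin n → ℕ
    layer≤k   : ∀ v → layer v ≤ k

    -- For v on a circle, `next v` is the counterclockwise next vertex on that
    -- circle (irrelevant for v in V_0).
    next      : Fin n → Fin n
    circle    : ∀ j → 1 ≤ j → CyclicOn (λ v → layer v ≡ j) next
    size≥3    : ∀ j → 1 ≤ j → j ≤ k → 3 ≤ count (λ v → layer v ≟ℕ j)

  -- The arc of a circle that runs counterclockwise from u to v.
  Arc : Rel (Fin n) 0ℓ
  Arc u v = 1 ≤ layer u × layer u ≡ layer v × next u ≡ v

  field
    induced   : ∀ u v → 1 ≤ layer u → layer u ≡ layer v →
                Adj G u v ⇔ (Arc u v ⊎ Arc v u)
    adjacent  : ∀ u v → Adj G u v → layer v ≤ suc (layer u)

    inner-connected : ConnectedOn G (λ v → layer v ≤ 1)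

    drawing   : SphericalDrawing G

  open SphericalDrawing drawing public

  -- At a vertex v of a circle, the counterclockwise order of the edges is:
  -- the arc to the next vertex, the edges inside the circle, the arc from the
  -- previous vertex, the edges outside the circle.  By the Jordan curve theorem
  -- every circle then separates the vertices of smaller layers from those of
  -- larger layers, so that the circles are nested and the edges between U_i
  -- and U_{i+1} lie in the annulus between O_i and O_{i+1}.  The circle O_k has
  -- nothing outside it, so it bounds a face, which is the unbounded one.
  field
    inside    : ∀ v w → 1 ≤ layer v → Adj G v w →
                Arc v w ⊎ layer w < layer v →
                layer (rot v w) < layer v ⊎ Arc (rot v w) v
    outside   : ∀ v w → 1 ≤ layer v → Adj G v w →
                Arc w v ⊎ layer v < layer w →
                layer v < layer (rot v w) ⊎ Arc v (rot v w)

  n₀ n₁ : ℕ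
  n₀ = count (λ v → layer v ≤? 0)
  n₁ = count (λ v → layer v ≤? 1)

{-# OPTIONS --safe #-}

-- The bound 20^(n/12) holds for every connected cubic graph without 3- and
-- 4-cycles, planar or not; it implies the weaker bound because 20 ≤ 27 = 3³.
--
-- For a proper subset S of the vertices, let m be the number of edges inside S.
-- By induction on S, its induced subgraph has at most 2^((2m - |S|)/6) perfect
-- matchings. By connectedness some v in S has at most two neighbours in S. A
-- vertex of degree 0 or 1 is immediate, so let all degrees be at least 2 and
-- branch over the two edges at v. Deleting the matched pair lowers 2m - |S| by
-- at least 6 in both branches if both neighbours have degree 3, and 2·2^(-6/6)
-- = 1. If a neighbour has degree 2, it becomes a leaf in the other branch,
-- which forces a further edge; as there are no short cycles, this lowers
-- 2m - |S| enough for a suitable v: by at least 6 and 6, or at least 4 and 10,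
-- with 2^(-4/6) + 2^(-10/6) < 1.
--
-- For the whole graph 2m = 3n, and branching over the three edges at a vertex
-- lowers 2m - n by 8, so that the number of perfect matchings is at most
-- 3·2^((2n - 8)/6). This is at most 20^(n/12) for n ≥ 10, and n ≥ 10 because a
-- vertex, its 3 neighbours and their 6 further neighbours are distinct.
module Submission where

open import Defs
open import Data.Nat using (ℕ; _*_; _∸_; _^_; _≤_; _<_)
open import Data.Product using (_×_)
open import Relation.Binary.PropositionalEquality using (_≡_)
open import Data.Nat using (zero; suc; NonZero; _+_; _⊔_; z≤n; s≤s; s≤s⁻¹; _≤?_)
open import Data.Nat.ListAction using (sum)
open import Data.Nat.ListAction.Properties using (sum-++)
open import Data.Nat.Properties hiding (_≟_; _<?_; _≤?_)
open import Algebra.Properties.CommutativeSemigroup *-commutativeSemigroup using (xy∙z≈xz∙y)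
open import Algebra.Properties.CommutativeSemigroup +-commutativeSemigroup using (interchange)
open import Data.Fin as Fin using (Fin; zero; suc; _<?_)
open import Data.Fin.Properties using (_≟_; any?) renaming (<-cmp to <-cmpꟳ; <-asym to <-asymꟳ)
open import Data.Fin.Subset using (Subset; _∈_; _∉_; _-_; ⁅_⁆; ∣_∣; Nonempty; ⊤; ⊥; inside; outside)
open import Data.Fin.Subset.Properties
  using (_∈?_; nonempty?; p─q⊆p; x∈p∧x≢y⇒x∈p-y; p─x─y≡p─y─x; p─⊥≡p; ∈⊤; x∈p⇒∣p-x∣<∣p∣;
         ∣⊤∣≡n; ∣⊥∣≡0; Empty-unique)
open import Data.List using (List; []; _∷_; _++_; map; filter; length; allFin; cartesianProduct)
open import Data.List.Membership.Propositional using () renaming (_∈_ to _∈ₗ_)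
open import Data.List.Membership.Propositional.Properties
  using (∈-∃++; ∈-++⁻; ∈-++⁺ˡ; ∈-++⁺ʳ; ∈-map⁺; ∈-map⁻; ∈-filter⁺; ∈-filter⁻; ∈-allFin; ∈-cartesianProduct⁺)
open import Data.List.Properties
  using (filter-++; filter-none; filter-accept; filter-reject; length-++; length-map; length-filter; length-tabulate;
         map-++; map-∘; map-cong)
open import Data.List.Relation.Binary.Subset.Propositional using (_⊆_)
open import Data.List.Relation.Unary.All as All using ([]; _∷_)
open import Data.List.Relation.Unary.AllPairs using ([]; _∷_)
open import Data.List.Relation.Unary.Any using (here; there)
open import Data.List.Relation.Unary.Unique.Propositional using (Unique)
import Data.List.Relation.Unary.Unique.Propositional.Properties as Unique
open import Data.Product using (_,_; ∃; ∃₂; proj₁; proj₂)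
open import Data.Sum using (inj₁; inj₂; [_,_])
open import Data.Vec as Vec using ()
open import Function using (_∘_; id)
open import Level using (0ℓ)
open import Relation.Binary.Construct.Closure.ReflexiveTransitive using (Star; ε; _◅_)
open import Relation.Binary.Definitions using (tri<; tri≈; tri>)
open import Relation.Binary.PropositionalEquality
  using (_≢_; refl; sym; trans; cong; cong₂; subst; subst₂; ≢-sym; module ≡-Reasoning)
open import Relation.Nullary using (¬_; Dec; yes; no; contradiction)
open import Relation.Nullary.Decidable using (_×-dec_; ¬?)
open import Relation.Unary using (Pred; Decidable)

-- Sums and lengths of lists

sum-map-++ : ∀ {A : Set} (g : A → ℕ) xs ys → sum (map g (xs ++ ys)) ≡ sum (map g xs) + sum (map g ys)
sum-map-++ g xs ys = trans (cong sum (map-++ g xs ys)) (sum-++ (map g xs) (map g ys))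

sum-map-mono : ∀ {A : Set} {g h : A → ℕ} xs → (∀ {x} → x ∈ₗ xs → g x ≤ h x) → sum (map g xs) ≤ sum (map h xs)
sum-map-mono []       g≤h = z≤n
sum-map-mono (x ∷ xs) g≤h = +-mono-≤ (g≤h (here refl)) (sum-map-mono xs (g≤h ∘ there))

sum-map-+ : ∀ {A : Set} (g h : A → ℕ) xs → sum (map g xs) + sum (map h xs) ≡ sum (map (λ x → g x + h x) xs)
sum-map-+ g h []       = refl
sum-map-+ g h (x ∷ xs) =
  trans (interchange (g x) _ (h x) _) (cong ((g x + h x) +_) (sum-map-+ g h xs))

-- Each entry `x` of `xs` claims one occurrence in `ys`. As `x` does not recur in `xs`, the other
-- entries are still found in `ys` when that occurrence is removed, and the induction continues.
sum-map-⊆ : ∀ {A : Set} (g : A → ℕ) {xs ys} → Unique xs → xs ⊆ ys → sum (map g xs) ≤ sum (map g ys)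
sum-map-⊆ g {[]}     _            _     = z≤n
sum-map-⊆ g {x ∷ xs} (x≢xs ∷ uxs) x∷xs⊆ with ∈-∃++ (x∷xs⊆ (here refl))
... | as , bs , refl = begin
  g x + sum (map g xs)                          ≤⟨ +-monoʳ-≤ (g x) (sum-map-⊆ g uxs xs⊆) ⟩
  g x + sum (map g (as ++ bs))                  ≡⟨ cong (g x +_) (sum-map-++ g as bs) ⟩
  g x + (sum (map g as) + sum (map g bs))       ≡⟨ +-assoc (g x) _ _ ⟨
  (g x + sum (map g as)) + sum (map g bs)       ≡⟨ cong (_+ sum (map g bs)) (+-comm (g x) _) ⟩
  (sum (map g as) + g x) + sum (map g bs)       ≡⟨ +-assoc (sum (map g as)) _ _ ⟩
  sum (map g as) + (g x + sum (map g bs))       ≡⟨ sum-map-++ g as (x ∷ bs) ⟨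
  sum (map g (as ++ x ∷ bs))                    ∎
  where
  open ≤-Reasoning
  xs⊆ : xs ⊆ as ++ bs
  xs⊆ {y} y∈xs with ∈-++⁻ as (x∷xs⊆ (there y∈xs))
  ... | inj₁ y∈as         = ∈-++⁺ˡ y∈as
  ... | inj₂ (here y≡x)   = contradiction (sym y≡x) (All.lookup x≢xs y∈xs)
  ... | inj₂ (there y∈bs) = ∈-++⁺ʳ as y∈bs

sum-const : ∀ {A : Set} c (xs : List A) → sum (map (λ _ → c) xs) ≡ length xs * c
sum-const c []       = refl
sum-const c (_ ∷ xs) = cong (c +_) (sum-const c xs)

sum-map-1 : ∀ {A : Set} (xs : List A) → sum (map (λ _ → 1) xs) ≡ length xs
sum-map-1 xs = trans (sum-const 1 xs) (*-identityʳ (length xs))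

length-⊆ : ∀ {A : Set} {xs ys : List A} → Unique xs → xs ⊆ ys → length xs ≤ length ys
length-⊆ {xs = xs} {ys} u xs⊆ys = subst₂ _≤_ (sum-map-1 xs) (sum-map-1 ys) (sum-map-⊆ (λ _ → 1) u xs⊆ys)

length-filter-map : ∀ {A B : Set} {P : Pred B 0ℓ} {Q : Pred A 0ℓ} (P? : Decidable P) (Q? : Decidable Q)
  (f : A → B) → (∀ x → P (f x) → Q x) → ∀ xs →
  length (filter P? (map f xs)) ≤ length (filter Q? xs)
length-filter-map P? Q? f P⇒Q [] = z≤n
length-filter-map P? Q? f P⇒Q (x ∷ xs) with P? (f x) | Q? x
... | yes p | yes q = s≤s (length-filter-map P? Q? f P⇒Q xs)
... | yes p | no ¬q = contradiction (P⇒Q x p) ¬q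
... | no ¬p | yes q = m≤n⇒m≤1+n (length-filter-map P? Q? f P⇒Q xs)
... | no ¬p | no ¬q = length-filter-map P? Q? f P⇒Q xs

-- The default value 0 turns a sum over a filtered list into a sum over the whole list, so that sums
-- with different filters can be compared entry by entry.
when : ∀ {P : Set} → Dec P → ℕ → ℕ
when (yes _) x = x
when (no _)  x = 0

when-yes : ∀ {P : Set} (d : Dec P) {x} → P → when d x ≡ x
when-yes (yes _) _ = refl
when-yes (no ¬p) p = contradiction p ¬p

when-no : ∀ {P : Set} (d : Dec P) {x} → ¬ P → when d x ≡ 0
when-no (yes p) ¬p = contradiction p ¬p
when-no (no _)  _  = refl

when-cong : ∀ {P Q : Set} (d : Dec P) (d′ : Dec Q) {x} → (P → Q) → (Q → P) → when d x ≡ when d′ x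
when-cong (yes p) d′ P⇒Q Q⇒P = sym (when-yes d′ (P⇒Q p))
when-cong (no ¬p) d′ P⇒Q Q⇒P = sym (when-no d′ (¬p ∘ Q⇒P))

when-mono : ∀ {P : Set} (d : Dec P) {x y} → (P → x ≤ y) → when d x ≤ when d y
when-mono (yes p) x≤y = x≤y p
when-mono (no _)  _   = z≤n

sum-when : ∀ {A : Set} {P : Pred A 0ℓ} (P? : Decidable P) (g : A → ℕ) xs →
  sum (map (λ x → when (P? x) (g x)) xs) ≡ sum (map g (filter P? xs))
sum-when P? g [] = refl
sum-when P? g (x ∷ xs) with P? x
... | yes _ = cong (g x +_) (sum-when P? g xs)
... | no _  = sum-when P? g xs

-- Counting perfect matchings of induced subgraphs

x∉p-x : ∀ {n} (p : Subset n) x → x ∉ p - x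
x∉p-x (_ Vec.∷ p) zero    ()
x∉p-x (_ Vec.∷ p) (suc x) (Vec.there x∈) = x∉p-x p x x∈

module _ {n : ℕ} where

  x∈p-y⇒x∈p : ∀ {p : Subset n} {x y} → x ∈ p - y → x ∈ p
  x∈p-y⇒x∈p {p} {y = y} = p─q⊆p p ⁅ y ⁆

  x∈p-y⇒x≢y : ∀ {p : Subset n} {x y} → x ∈ p - y → x ≢ y
  x∈p-y⇒x≢y {p} {x} x∈ refl = x∉p-x p x x∈

  Edge : Set
  Edge = Fin n × Fin n

  Within : Subset n → Edge → Set
  Within S (a , b) = a ∈ S × b ∈ S

  within? : ∀ S e → Dec (Within S e)
  within? S (a , b) = (a ∈? S) ×-dec (b ∈? S)

  infixl 5 _∖_
  _∖_ : Subset n → Edge → Subset n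
  S ∖ (a , b) = S - a - b

  ∖-comm : ∀ S d e → S ∖ d ∖ e ≡ S ∖ e ∖ d
  ∖-comm S (a , b) (c , d) = begin
    S - a - b - c - d ≡⟨ cong (_- d) (p─x─y≡p─y─x (S - a) b c) ⟩
    S - a - c - b - d ≡⟨ p─x─y≡p─y─x (S - a - c) b d ⟩
    S - a - c - d - b ≡⟨ cong (λ T → T - d - b) (p─x─y≡p─y─x S a c) ⟩
    S - c - a - d - b ≡⟨ cong (_- b) (p─x─y≡p─y─x (S - c) a d) ⟩
    S - c - d - a - b ∎
    where open ≡-Reasoning

  -- The number of sublists of es that are perfect matchings of S, by whether
  -- they use the first edge.
  matchings : List Edge → Subset n → ℕ
  matchings []       S = when (¬? (nonempty? S)) 1
  matchings (e ∷ es) S = matchings es S + when (within? S e) (matchings es (S ∖ e))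

  -- Vertices outside `S` must stay uncovered. This makes the property inductive: splitting off an
  -- edge removes its ends from `S`, and the rest of the matching has to avoid them.
  Exact : Subset n → List Edge → Set
  Exact S M = ∀ v → length (filter (incident? v) M) ≡ when (v ∈? S) 1

  Exact-[] : ∀ S → Exact S [] → ¬ Nonempty S
  Exact-[] S ex (v , v∈S) with v ∈? S | ex v
  ... | no v∉S | _ = v∉S v∈S
  ... | yes _  | ()

  Exact-within : ∀ S e M → Exact S (e ∷ M) → Within S e
  Exact-within S (a , b) M ex = covered a (inj₁ refl) , covered b (inj₂ refl)
    where
    covered : ∀ v → Incident v (a , b) → v ∈ S
    covered v v∈e
      with v ∈? S | trans (sym (cong length (filter-accept (incident? v) {xs = M} v∈e))) (ex v)
    ... | yes v∈S | _ = v∈S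
    ... | no _ | ()

  x∈p∖e : ∀ {S x} e → x ∈ S → ¬ Incident x e → x ∈ S ∖ e
  x∈p∖e _ x∈S x∉e = x∈p∧x≢y⇒x∈p-y (x∈p∧x≢y⇒x∈p-y x∈S (x∉e ∘ inj₁)) (x∉e ∘ inj₂)

  x∈p∖e⁻ : ∀ {S x} e → x ∈ S ∖ e → x ∈ S × ¬ Incident x e
  x∈p∖e⁻ _ x∈ = x∈p-y⇒x∈p (x∈p-y⇒x∈p x∈) , [ x∈p-y⇒x≢y (x∈p-y⇒x∈p x∈) , x∈p-y⇒x≢y x∈ ]

  Exact-∷ : ∀ S e M → Exact S (e ∷ M) → Exact (S ∖ e) M
  Exact-∷ S e M ex v with incident? v e
  ... | yes v∈e = suc-injective (begin
    suc (length (filter (incident? v) M)) ≡⟨ cong length (filter-accept (incident? v) v∈e) ⟨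
    length (filter (incident? v) (e ∷ M)) ≡⟨ ex v ⟩
    when (v ∈? S) 1 ≡⟨ when-yes (v ∈? S) v∈S ⟩
    1 ≡⟨ cong suc (when-no (v ∈? (S ∖ e)) (λ v∈ → proj₂ (x∈p∖e⁻ e v∈) v∈e)) ⟨
    suc (when (v ∈? (S ∖ e)) 1) ∎)
    where
    open ≡-Reasoning
    v∈S : v ∈ S
    v∈S = [ (λ { refl → proj₁ (Exact-within S e M ex) }) , (λ { refl → proj₂ (Exact-within S e M ex) }) ] v∈e
  ... | no v∉e = begin
    length (filter (incident? v) M) ≡⟨ cong length (filter-reject (incident? v) v∉e) ⟨
    length (filter (incident? v) (e ∷ M)) ≡⟨ ex v ⟩
    when (v ∈? S) 1 ≡⟨ when-cong (v ∈? S) (v ∈? (S ∖ e)) (λ v∈S → x∈p∖e e v∈S v∉e) (proj₁ ∘ x∈p∖e⁻ e) ⟩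
    when (v ∈? (S ∖ e)) 1 ∎
    where
    open ≡-Reasoning

  -- A general predicate `P` is used because the sublists that begin with `e` are tested by a
  -- shifted predicate, which implies exactness for `S` without the ends of `e`. If `e` is not
  -- within `S`, no such sublist passes.
  length-filter-sublists : ∀ {P : Pred (List Edge) 0ℓ} (P? : Decidable P) S es → (∀ M → P M → Exact S M) →
    length (filter P? (sublists es)) ≤ matchings es S
  length-filter-sublists P? S [] P⇒ with P? [] | nonempty? S
  ... | yes p | yes ne = contradiction ne (Exact-[] S (P⇒ [] p))
  ... | yes p | no _ = ≤-refl
  ... | no _ | _ = z≤n
  length-filter-sublists {P} P? S (e ∷ es) P⇒ = begin
    length (filter P? (sublists es ++ map (e ∷_) (sublists es)))
      ≡⟨ cong length (filter-++ P? (sublists es) _) ⟩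
    length (filter P? (sublists es) ++ filter P? (map (e ∷_) (sublists es)))
      ≡⟨ length-++ (filter P? (sublists es)) ⟩
    length (filter P? (sublists es)) + length (filter P? (map (e ∷_) (sublists es)))
      ≤⟨ +-mono-≤ (length-filter-sublists P? S es P⇒) second ⟩
    matchings (e ∷ es) S ∎
    where
    open ≤-Reasoning
    P∷? : Decidable (λ M → P (e ∷ M))
    P∷? M = P? (e ∷ M)
    drop-e : length (filter P? (map (e ∷_) (sublists es))) ≤ length (filter P∷? (sublists es))
    drop-e = length-filter-map P? P∷? (e ∷_) (λ _ p → p) (sublists es)
    second : length (filter P? (map (e ∷_) (sublists es))) ≤ when (within? S e) (matchings es (S ∖ e))
    second with within? S e
    ... | yes _ = ≤-trans drop-e
          (length-filter-sublists P∷? (S ∖ e) es (λ M p → Exact-∷ S e M (P⇒ (e ∷ M) p)))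
    ... | no e⊈S = ≤-trans drop-e (≤-reflexive (cong length (filter-none P∷?
          (All.universal (λ M p → e⊈S (Exact-within S e M (P⇒ (e ∷ M) p))) (sublists es)))))

  InStar : Subset n → Fin n → Edge → Set
  InStar S v e = Incident v e × Within S e

  inStar? : ∀ S v e → Dec (InStar S v e)
  inStar? S v e = incident? v e ×-dec within? S e

  -- Disjointness of two edges is symmetric, so they can be removed in either order.
  within-∖ : ∀ {S} d e → Within S d → Within (S ∖ d) e → Within S e × Within (S ∖ e) d
  within-∖ d e@(c , f) (a∈ , b∈) (c∈ , f∈) with x∈p∖e⁻ d c∈ | x∈p∖e⁻ d f∈
  ... | c∈S , c∉d | f∈S , f∉d = (c∈S , f∈S) ,
    (x∈p∖e e a∈ [ (λ a≡c → c∉d (inj₁ (sym a≡c))) , (λ a≡f → f∉d (inj₁ (sym a≡f))) ] ,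
     x∈p∖e e b∈ [ (λ b≡c → c∉d (inj₂ (sym b≡c))) , (λ b≡f → f∉d (inj₂ (sym b≡f))) ])

  when-star : ∀ S v e {x} → Incident v e → when (inStar? S v e) x ≡ when (within? S e) x
  when-star S v e v∈e = when-cong (inStar? S v e) (within? S e) proj₂ (v∈e ,_)

  -- The candidates `ds` for the edge at `v` and the edges `es` available for the rest are separate
  -- arguments, so that the induction in `matchings-star` can extend them one after the other.
  star-sum : List Edge → List Edge → Subset n → Fin n → ℕ
  star-sum ds es S v = sum (map (λ d → when (inStar? S v d) (matchings es (S ∖ d))) ds)

  star-sum-∷ : ∀ ds e es S v → star-sum ds es S v ≤ star-sum ds (e ∷ es) S v
  star-sum-∷ ds e es S v = sum-map-mono ds λ {d} _ → when-mono (inStar? S v d) (λ _ → m≤m+n _ _)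

  -- For each candidate `d`, the matchings of the remaining vertices split by whether they use `e`.
  -- Those that do are counted on the left with `e` removed before `d`, and the two removals
  -- commute.
  star-sum-∖ : ∀ ds e es S v → Within S e →
    star-sum ds es S v + star-sum ds es (S ∖ e) v ≤ star-sum ds (e ∷ es) S v
  star-sum-∖ ds e es S v e⊆S =
    ≤-trans (≤-reflexive (sum-map-+ _ _ ds)) (sum-map-mono ds λ {d} _ → swap d)
    where
    swap : ∀ d → when (inStar? S v d) (matchings es (S ∖ d)) +
                 when (inStar? (S ∖ e) v d) (matchings es (S ∖ e ∖ d)) ≤
                 when (inStar? S v d) (matchings (e ∷ es) (S ∖ d))
    swap d with inStar? (S ∖ e) v d
    ... | no _ = ≤-trans (≤-reflexive (+-identityʳ _)) (when-mono (inStar? S v d) (λ _ → m≤m+n _ _))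
    ... | yes (v∈d , d⊆S∖e) with within-∖ e d e⊆S d⊆S∖e
    ...   | d⊆S , e⊆S∖d = ≤-reflexive (begin
      when (inStar? S v d) (matchings es (S ∖ d)) + matchings es (S ∖ e ∖ d)
        ≡⟨ cong₂ _+_ (when-yes (inStar? S v d) (v∈d , d⊆S)) (cong (matchings es) (∖-comm S e d)) ⟩
      matchings es (S ∖ d) + matchings es (S ∖ d ∖ e)
        ≡⟨ cong (matchings es (S ∖ d) +_) (when-yes (within? (S ∖ d) e) e⊆S∖d) ⟨
      matchings (e ∷ es) (S ∖ d)
        ≡⟨ when-yes (inStar? S v d) (v∈d , d⊆S) ⟨
      when (inStar? S v d) (matchings (e ∷ es) (S ∖ d)) ∎)
      where open ≡-Reasoning

  -- A perfect matching of `S` covers `v` by some listed edge. If the first edge `e` contains `v`,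
  -- the matchings using `e` give the new summand; if not, `v` survives the removal of `e`, and both
  -- halves of the count are expanded at `v`.
  matchings-star : ∀ es S v → v ∈ S → matchings es S ≤ star-sum es es S v
  matchings-star [] S v v∈S = ≤-reflexive (when-no (¬? (nonempty? S)) (λ ¬ne → ¬ne (v , v∈S)))
  matchings-star (e ∷ es) S v v∈S = split (incident? v e) (within? S e)
    where
    open ≤-Reasoning
    later : star-sum es es S v ≤ star-sum (e ∷ es) (e ∷ es) S v
    later = ≤-trans (star-sum-∷ es e es S v) (m≤n+m _ _)
    split : Dec (Incident v e) → Dec (Within S e) → matchings (e ∷ es) S ≤ star-sum (e ∷ es) (e ∷ es) S v
    split (yes v∈e) _ = begin
      matchings es S + when (within? S e) (matchings es (S ∖ e))
        ≤⟨ +-mono-≤ (matchings-star es S v v∈S) (when-mono (within? S e) (λ _ → m≤m+n _ _)) ⟩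
      star-sum es es S v + when (within? S e) (matchings (e ∷ es) (S ∖ e))
        ≤⟨ +-mono-≤ (star-sum-∷ es e es S v) (≤-reflexive (sym (when-star S v e v∈e))) ⟩
      star-sum es (e ∷ es) S v + when (inStar? S v e) (matchings (e ∷ es) (S ∖ e))
        ≡⟨ +-comm (star-sum es (e ∷ es) S v) _ ⟩
      star-sum (e ∷ es) (e ∷ es) S v ∎
    split (no _) (no e⊈S) = begin
      matchings es S + when (within? S e) (matchings es (S ∖ e))
        ≡⟨ cong (matchings es S +_) (when-no (within? S e) e⊈S) ⟩
      matchings es S + 0             ≡⟨ +-identityʳ _ ⟩
      matchings es S                 ≤⟨ matchings-star es S v v∈S ⟩
      star-sum es es S v             ≤⟨ later ⟩
      star-sum (e ∷ es) (e ∷ es) S v ∎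
    split (no v∉e) (yes e⊆S) = begin
      matchings es S + when (within? S e) (matchings es (S ∖ e))
        ≡⟨ cong (matchings es S +_) (when-yes (within? S e) e⊆S) ⟩
      matchings es S + matchings es (S ∖ e)
        ≤⟨ +-mono-≤ (matchings-star es S v v∈S) (matchings-star es (S ∖ e) v (x∈p∖e e v∈S v∉e)) ⟩
      star-sum es es S v + star-sum es es (S ∖ e) v
        ≤⟨ star-sum-∖ es e es S v e⊆S ⟩
      star-sum es (e ∷ es) S v
        ≤⟨ m≤n+m _ _ ⟩
      star-sum (e ∷ es) (e ∷ es) S v ∎

  matchings-expand : ∀ es S v → v ∈ S →
    matchings es S ≤ sum (map (λ e → matchings es (S ∖ e)) (filter (inStar? S v) es))
  matchings-expand es S v v∈S =
    ≤-trans (matchings-star es S v v∈S) (≤-reflexive (sum-when (inStar? S v) _ es))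

-- Cardinalities and the numerical side of the branching

∣p∣≤1+∣p-x∣ : ∀ {n} (p : Subset n) x → ∣ p ∣ ≤ suc ∣ p - x ∣
∣p∣≤1+∣p-x∣ (inside Vec.∷ p)  zero    = s≤s (≤-reflexive (cong ∣_∣ (sym (p─⊥≡p p))))
∣p∣≤1+∣p-x∣ (outside Vec.∷ p) zero    = m≤n⇒m≤1+n (≤-reflexive (cong ∣_∣ (sym (p─⊥≡p p))))
∣p∣≤1+∣p-x∣ (inside Vec.∷ p)  (suc x) = s≤s (∣p∣≤1+∣p-x∣ p x)
∣p∣≤1+∣p-x∣ (outside Vec.∷ p) (suc x) = ∣p∣≤1+∣p-x∣ p x

^-distribʳ-* : ∀ k x y → (x * y) ^ k ≡ x ^ k * y ^ k
^-distribʳ-* zero    x y = refl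
^-distribʳ-* (suc k) x y = trans (cong (x * y *_) (^-distribʳ-* k x y)) ([m*n]*[o*p]≡[m*o]*[n*p] x y (x ^ k) (y ^ k))

⊔-bound : ∀ x y k c P Q → x ^ k * c * P ≤ Q → y ^ k * c * P ≤ Q → (x ⊔ y) ^ k * c * P ≤ Q
⊔-bound x y k c P Q x≤ y≤ with ⊔-sel x y
... | inj₁ eq = subst (λ z → z ^ k * c * P ≤ Q) (sym eq) x≤
... | inj₂ eq = subst (λ z → z ^ k * c * P ≤ Q) (sym eq) y≤

-- The maximum `M` of `y` and `z` satisfies their common bound, and `x` is at most `M * 2`. This is
-- the balanced case 2·2^(-6/6) = 1.
branch-6-6 : ∀ x y z P Q → y ^ 6 * 2 ^ 6 * P ≤ Q → z ^ 6 * 2 ^ 6 * P ≤ Q → x ≤ y + z → x ^ 6 * P ≤ Q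
branch-6-6 x y z P Q y≤ z≤ x≤ = begin
  x ^ 6 * P             ≤⟨ *-monoˡ-≤ P (^-monoˡ-≤ 6 x≤M*2) ⟩
  (M * 2) ^ 6 * P       ≡⟨ cong (_* P) (^-distribʳ-* 6 M 2) ⟩
  M ^ 6 * 2 ^ 6 * P     ≤⟨ ⊔-bound y z 6 (2 ^ 6) P Q y≤ z≤ ⟩
  Q                     ∎
  where
  open ≤-Reasoning
  M : ℕ
  M = y ⊔ z
  x≤M*2 : x ≤ M * 2
  x≤M*2 = begin
    x         ≤⟨ x≤ ⟩
    y + z     ≤⟨ +-mono-≤ (m≤m⊔n y z) (m≤n⊔m y z) ⟩
    M + M     ≡⟨ cong (M +_) (*-identityʳ M) ⟨
    M + M * 1 ≡⟨ *-suc M 1 ⟨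
    M * 2     ∎

-- Here y and 2z satisfy the same bound, hence so does their maximum M, and
-- x ≤ 3M/2 with (3/2)⁶ ≤ 2⁴.
branch-4-10 : ∀ x y z P Q → y ^ 6 * 2 ^ 4 * P ≤ Q → z ^ 6 * 2 ^ 10 * P ≤ Q → x ≤ y + z → x ^ 6 * P ≤ Q
branch-4-10 x y z P Q y≤ z≤ x≤ = *-cancelʳ-≤ (x ^ 6 * P) Q (2 ^ 6) (begin
  x ^ 6 * P * 2 ^ 6             ≡⟨ xy∙z≈xz∙y (x ^ 6) P (2 ^ 6) ⟩
  x ^ 6 * 2 ^ 6 * P             ≡⟨ cong (_* P) (^-distribʳ-* 6 x 2) ⟨
  (x * 2) ^ 6 * P               ≤⟨ *-monoˡ-≤ P (^-monoˡ-≤ 6 x*2≤M*3) ⟩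
  (M * 3) ^ 6 * P               ≡⟨ cong (_* P) (^-distribʳ-* 6 M 3) ⟩
  M ^ 6 * 3 ^ 6 * P             ≤⟨ *-monoˡ-≤ P (*-monoʳ-≤ (M ^ 6) (≤ᵇ⇒≤ (3 ^ 6) (2 ^ 4 * 2 ^ 6) _)) ⟩
  M ^ 6 * (2 ^ 4 * 2 ^ 6) * P   ≡⟨ cong (_* P) (*-assoc (M ^ 6) (2 ^ 4) (2 ^ 6)) ⟨
  M ^ 6 * 2 ^ 4 * 2 ^ 6 * P     ≡⟨ xy∙z≈xz∙y (M ^ 6 * 2 ^ 4) (2 ^ 6) P ⟩
  M ^ 6 * 2 ^ 4 * P * 2 ^ 6     ≤⟨ *-monoˡ-≤ (2 ^ 6) (⊔-bound y (z * 2) 6 (2 ^ 4) P Q y≤ 2z≤) ⟩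
  Q * 2 ^ 6                     ∎)
  where
  open ≤-Reasoning
  M : ℕ
  M = y ⊔ z * 2
  2z≤ : (z * 2) ^ 6 * 2 ^ 4 * P ≤ Q
  2z≤ = begin
    (z * 2) ^ 6 * 2 ^ 4 * P     ≡⟨ cong (λ w → w * 2 ^ 4 * P) (^-distribʳ-* 6 z 2) ⟩
    z ^ 6 * 2 ^ 6 * 2 ^ 4 * P   ≡⟨ cong (_* P) (*-assoc (z ^ 6) (2 ^ 6) (2 ^ 4)) ⟩
    z ^ 6 * 2 ^ 10 * P          ≤⟨ z≤ ⟩
    Q                           ∎
  x*2≤M*3 : x * 2 ≤ M * 3
  x*2≤M*3 = begin
    x * 2             ≤⟨ *-monoˡ-≤ 2 x≤ ⟩
    (y + z) * 2       ≡⟨ *-distribʳ-+ 2 y z ⟩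
    y * 2 + z * 2     ≤⟨ +-mono-≤ (*-monoˡ-≤ 2 (m≤m⊔n y (z * 2))) (m≤n⊔m y (z * 2)) ⟩
    M * 2 + M         ≡⟨ +-comm (M * 2) M ⟩
    M + M * 2         ≡⟨ *-suc M 2 ⟨
    M * 3             ∎

-- Beyond the exponent `k`, every further factor is `x` on the left and the larger `y` on the right.
^-growth : ∀ A B x y k n → k ≤ n → x ≤ y → A * x ^ k ≤ B * y ^ k → A * x ^ n ≤ B * y ^ n
^-growth A B x y k n k≤n x≤y base = begin
  A * x ^ n                   ≡⟨ split A x ⟨
  A * x ^ k * x ^ (n ∸ k)     ≤⟨ *-mono-≤ base (^-monoˡ-≤ (n ∸ k) x≤y) ⟩
  B * y ^ k * y ^ (n ∸ k)     ≡⟨ split B y ⟩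
  B * y ^ n                   ∎
  where
  open ≤-Reasoning
  split : ∀ C z → C * z ^ k * z ^ (n ∸ k) ≡ C * z ^ n
  split C z = begin-equality
    C * z ^ k * z ^ (n ∸ k)     ≡⟨ *-assoc C (z ^ k) (z ^ (n ∸ k)) ⟩
    C * (z ^ k * z ^ (n ∸ k))   ≡⟨ cong (C *_) (^-distribˡ-+-* z k (n ∸ k)) ⟨
    C * z ^ (k + (n ∸ k))       ≡⟨ cong (λ j → C * z ^ j) (m+[n∸m]≡n k≤n) ⟩
    C * z ^ n                   ∎

-- Cancelling `2 ^ n` leaves `d * 2 ^ (n * 2)` on the right; squaring then gives the exponent 12 on
-- the left and the base 16 on the right.
square-bound : ∀ t n c d → t ^ 6 * c * 2 ^ n ≤ d * 2 ^ (n * 3) → t ^ 12 * c ^ 2 ≤ d ^ 2 * 16 ^ n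
square-bound t n c d t≤ = begin
  t ^ 12 * c ^ 2                 ≡⟨ cong (_* c ^ 2) (^-*-assoc t 6 2) ⟨
  (t ^ 6) ^ 2 * c ^ 2            ≡⟨ ^-distribʳ-* 2 (t ^ 6) c ⟨
  (t ^ 6 * c) ^ 2                ≤⟨ ^-monoˡ-≤ 2 root ⟩
  (d * 2 ^ (n * 2)) ^ 2          ≡⟨ ^-distribʳ-* 2 d (2 ^ (n * 2)) ⟩
  d ^ 2 * (2 ^ (n * 2)) ^ 2      ≡⟨ cong (d ^ 2 *_) 16^n ⟩
  d ^ 2 * 16 ^ n                 ∎
  where
  open ≤-Reasoning
  16^n : (2 ^ (n * 2)) ^ 2 ≡ 16 ^ n
  16^n = begin-equality
    (2 ^ (n * 2)) ^ 2   ≡⟨ ^-*-assoc 2 (n * 2) 2 ⟩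
    2 ^ (n * 2 * 2)     ≡⟨ cong (2 ^_) (trans (*-assoc n 2 2) (*-comm n 4)) ⟩
    2 ^ (4 * n)         ≡⟨ ^-*-assoc 2 4 n ⟨
    16 ^ n              ∎
  root : t ^ 6 * c ≤ d * 2 ^ (n * 2)
  root = *-cancelʳ-≤ (t ^ 6 * c) (d * 2 ^ (n * 2)) (2 ^ n) {{m^n≢0 2 n}} (begin
    t ^ 6 * c * 2 ^ n           ≤⟨ t≤ ⟩
    d * 2 ^ (n * 3)             ≡⟨ cong (λ k → d * 2 ^ k) (trans (*-suc n 2) (+-comm n (n * 2))) ⟩
    d * 2 ^ (n * 2 + n)         ≡⟨ cong (d *_) (^-distribˡ-+-* 2 (n * 2) n) ⟩
    d * (2 ^ (n * 2) * 2 ^ n)   ≡⟨ *-assoc d (2 ^ (n * 2)) (2 ^ n) ⟨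
    d * 2 ^ (n * 2) * 2 ^ n     ∎)

-- Since 16 < 20, the constant factor is absorbed as soon as `n` reaches `k`.
cancel-constants : ∀ t n c d k .{{_ : NonZero c}} → k ≤ n → d ^ 2 * 16 ^ k ≤ c ^ 2 * 20 ^ k →
  t ^ 6 * c * 2 ^ n ≤ d * 2 ^ (n * 3) → t ^ 12 ≤ 20 ^ n
cancel-constants t n c d k k≤n base t≤ = *-cancelˡ-≤ (c ^ 2) {{m^n≢0 c 2}} (begin
  c ^ 2 * t ^ 12   ≡⟨ *-comm (c ^ 2) (t ^ 12) ⟩
  t ^ 12 * c ^ 2   ≤⟨ square-bound t n c d t≤ ⟩
  d ^ 2 * 16 ^ n   ≤⟨ ^-growth (d ^ 2) (c ^ 2) 16 20 k n k≤n (≤ᵇ⇒≤ 16 20 _) base ⟩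
  c ^ 2 * 20 ^ n   ∎)
  where open ≤-Reasoning

sum-bound : ∀ {A : Set} (g : A → ℕ) k c P Q xs → (∀ {x} → x ∈ₗ xs → g x ^ suc k * c * P ≤ Q) →
  sum (map g xs) ^ suc k * c * P ≤ length xs ^ suc k * Q
sum-bound g k c P Q xs bound = let M , g≤M , M≤ = maximum xs bound in begin
  sum (map g xs) ^ suc k * c * P          ≤⟨ *-monoˡ-≤ P (*-monoˡ-≤ c (^-monoˡ-≤ (suc k) g≤M)) ⟩
  (length xs * M) ^ suc k * c * P         ≡⟨ cong (λ y → y * c * P) (^-distribʳ-* (suc k) (length xs) M) ⟩
  length xs ^ suc k * M ^ suc k * c * P   ≡⟨ cong (_* P) (*-assoc (length xs ^ suc k) _ c) ⟩
  length xs ^ suc k * (M ^ suc k * c) * P ≡⟨ *-assoc (length xs ^ suc k) _ P ⟩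
  length xs ^ suc k * (M ^ suc k * c * P) ≤⟨ *-monoʳ-≤ (length xs ^ suc k) M≤ ⟩
  length xs ^ suc k * Q                   ∎
  where
  open ≤-Reasoning
  maximum : ∀ xs → (∀ {x} → x ∈ₗ xs → g x ^ suc k * c * P ≤ Q) →
    ∃ λ M → sum (map g xs) ≤ length xs * M × M ^ suc k * c * P ≤ Q
  -- The empty list gets the maximum 0, whose power vanishes because the exponent `suc k` is
  -- positive.
  maximum []       _     = 0 , z≤n , z≤n
  maximum (x ∷ xs) bound = let M , g≤M , M≤ = maximum xs (bound ∘ there) in
    g x ⊔ M ,
    +-mono-≤ (m≤m⊔n (g x) M) (≤-trans g≤M (*-monoʳ-≤ (length xs) (m≤n⊔m (g x) M))) ,
    ⊔-bound (g x) M (suc k) c P Q (bound (here refl)) M≤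

length-filter-∷ : ∀ {A : Set} {P : Pred A 0ℓ} (P? : Decidable P) x xs →
  length (filter P? (x ∷ xs)) ≡ when (P? x) 1 + length (filter P? xs)
length-filter-∷ P? x xs with P? x
... | yes _ = refl
... | no _  = refl

-- Edges, neighbours and degrees inside a vertex set

module _ {n : ℕ} (G : SimpleGraph n) where

  private
    es : List (Edge {n})
    es = edges G

    infix 4 _~_
    _~_ : Fin n → Fin n → Set
    _~_ = Adj G

    ~-sym : ∀ {v w} → v ~ w → w ~ v
    ~-sym = SimpleGraph.sym G

    ~⇒≢ : ∀ {v w} → v ~ w → v ≢ w
    ~⇒≢ v~w v≡w = SimpleGraph.irrefl G v≡w v~w

  pm : Subset n → ℕ
  pm = matchings es

  size : Subset n → ℕ
  size S = length (filter (within? S) es)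

  nbs : Subset n → Fin n → List (Fin n)
  nbs S v = filter (λ w → adj? G v w ×-dec (w ∈? S)) (allFin n)

  deg : Subset n → Fin n → ℕ
  deg S v = length (nbs S v)

  ∈-nbs⁺ : ∀ {S v w} → v ~ w → w ∈ S → w ∈ₗ nbs S v
  ∈-nbs⁺ {S} {v} {w} v~w w∈S = ∈-filter⁺ (λ w → adj? G v w ×-dec (w ∈? S)) (∈-allFin w) (v~w , w∈S)

  ∈-nbs⁻ : ∀ {S v w} → w ∈ₗ nbs S v → v ~ w × w ∈ S
  ∈-nbs⁻ {S} {v} w∈ = proj₂ (∈-filter⁻ (λ w → adj? G v w ×-dec (w ∈? S)) {xs = allFin n} w∈)

  nbs-unique : ∀ S v → Unique (nbs S v)
  nbs-unique S v = Unique.filter⁺ _ (Unique.allFin⁺ n)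

  -- For adjacent vertices this is the orientation listed in `edges`, with the smaller endpoint
  -- first.
  edge : Fin n → Fin n → Edge
  edge v w with v <? w
  ... | yes _ = v , w
  ... | no _  = w , v

  edge-< : ∀ {v w} → v Fin.< w → edge v w ≡ (v , w)
  edge-< {v} {w} v<w with v <? w
  ... | yes _  = refl
  ... | no v≮w = contradiction v<w v≮w

  edge-> : ∀ {v w} → w Fin.< v → edge v w ≡ (w , v)
  edge-> {v} {w} w<v with v <? w
  ... | yes v<w = contradiction w<v (<-asymꟳ v<w)
  ... | no _    = refl

  edge-injective : ∀ v {w x} → edge v w ≡ edge v x → w ≡ x
  edge-injective v {w} {x} eq with v <? w | v <? x | eq
  ... | yes _ | yes _ | refl = refl
  ... | yes _ | no _  | refl = refl
  ... | no _  | yes _ | refl = refl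
  ... | no _  | no _  | refl = refl

  edge-∖ : ∀ S v w → S ∖ edge v w ≡ S - v - w
  edge-∖ S v w with v <? w
  ... | yes _ = refl
  ... | no _  = p─x─y≡p─y─x S w v

  edge-within⁺ : ∀ {S v w} → v ∈ S → w ∈ S → Within S (edge v w)
  edge-within⁺ {S} {v} {w} v∈S w∈S with v <? w
  ... | yes _ = v∈S , w∈S
  ... | no _  = w∈S , v∈S

  edge-within⁻ : ∀ {S} v w → Within S (edge v w) → v ∈ S
  edge-within⁻ {S} v w with v <? w
  ... | yes _ = proj₁
  ... | no _  = proj₂

  private
    listed? : Decidable (λ e → (proj₁ e Fin.< proj₂ e) × (proj₁ e ~ proj₂ e))
    listed? e = (proj₁ e <? proj₂ e) ×-dec adj? G (proj₁ e) (proj₂ e)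

  edges-unique : Unique es
  edges-unique = Unique.filter⁺ listed? (Unique.cartesianProduct⁺ (Unique.allFin⁺ n) (Unique.allFin⁺ n))

  ∈-edges⁺ : ∀ {a b} → a Fin.< b → a ~ b → (a , b) ∈ₗ es
  ∈-edges⁺ {a} {b} a<b a~b = ∈-filter⁺ listed? (∈-cartesianProduct⁺ (∈-allFin a) (∈-allFin b)) (a<b , a~b)

  ∈-edges⁻ : ∀ {a b} → (a , b) ∈ₗ es → a Fin.< b × a ~ b
  ∈-edges⁻ e∈ = proj₂ (∈-filter⁻ listed? {xs = cartesianProduct (allFin n) (allFin n)} e∈)

  edge-∈ : ∀ {v w} → v ~ w → edge v w ∈ₗ es
  edge-∈ {v} {w} v~w with <-cmpꟳ v w
  ... | tri< v<w _ _ = subst (_∈ₗ es) (sym (edge-< v<w)) (∈-edges⁺ v<w v~w)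
  ... | tri≈ _ v≡w _ = contradiction v≡w (~⇒≢ v~w)
  ... | tri> _ _ w<v = subst (_∈ₗ es) (sym (edge-> w<v)) (∈-edges⁺ w<v (~-sym v~w))

  star-⊆ : ∀ S v → filter (inStar? S v) es ⊆ map (edge v) (nbs S v)
  star-⊆ S v {a , b} e∈ with ∈-filter⁻ (inStar? S v) {xs = es} e∈
  ... | e∈es , v∈e , a∈S , b∈S with ∈-edges⁻ e∈es | v∈e
  ...   | a<b , a~b | inj₁ refl = subst (_∈ₗ _) (edge-< a<b) (∈-map⁺ (edge v) (∈-nbs⁺ a~b b∈S))
  ...   | a<b , a~b | inj₂ refl = subst (_∈ₗ _) (edge-> a<b) (∈-map⁺ (edge v) (∈-nbs⁺ (~-sym a~b) a∈S))

  -- The vertex `v` has to be matched with one of its neighbours in `S`. Since `ws` only has to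
  -- contain them, explicit lists of at most two vertices can be inserted directly.
  pm-expand : ∀ {S v} ws → v ∈ S → nbs S v ⊆ ws → pm S ≤ sum (map (λ w → pm (S - v - w)) ws)
  pm-expand {S} {v} ws v∈S nbs⊆ws = begin
    pm S ≤⟨ matchings-expand es S v v∈S ⟩
    sum (map (λ e → pm (S ∖ e)) (filter (inStar? S v) es))
      ≤⟨ sum-map-⊆ _ (Unique.filter⁺ (inStar? S v) edges-unique) (star-⊆ S v) ⟩
    sum (map (λ e → pm (S ∖ e)) (map (edge v) (nbs S v)))
      ≡⟨ cong sum (map-∘ (nbs S v)) ⟨
    sum (map (λ w → pm (S ∖ edge v w)) (nbs S v))
      ≡⟨ cong sum (map-cong (λ w → cong pm (edge-∖ S v w)) (nbs S v)) ⟩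
    sum (map (λ w → pm (S - v - w)) (nbs S v))
      ≤⟨ sum-map-⊆ _ (nbs-unique S v) nbs⊆ws ⟩
    sum (map (λ w → pm (S - v - w)) ws) ∎
    where open ≤-Reasoning

  perfmat≤pm⊤ : perfmat G ≤ pm ⊤
  perfmat≤pm⊤ = length-filter-sublists coversOnce? ⊤ es
    (λ M covers v → trans (covers v) (sym (when-yes (v ∈? ⊤) ∈⊤)))

  -- The edges inside `S - v` and the edges from `v` into `S` are disjoint families of edges inside
  -- `S`.
  size-remove : ∀ {S v} → v ∈ S → size (S - v) + deg S v ≤ size S
  size-remove {S} {v} v∈S = begin
    size (S - v) + deg S v ≡⟨ cong (size (S - v) +_) (length-map (edge v) (nbs S v)) ⟨
    size (S - v) + length (map (edge v) (nbs S v)) ≡⟨ length-++ (filter (within? (S - v)) es) ⟨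
    length (filter (within? (S - v)) es ++ map (edge v) (nbs S v)) ≤⟨ length-⊆ unique ⊆-within ⟩
    size S ∎
    where
    open ≤-Reasoning
    unique : Unique (filter (within? (S - v)) es ++ map (edge v) (nbs S v))
    unique = Unique.++⁺ (Unique.filter⁺ _ edges-unique) (Unique.map⁺ (edge-injective v) (nbs-unique S v)) disjoint
      where
      disjoint : ∀ {e} → ¬ (e ∈ₗ filter (within? (S - v)) es × e ∈ₗ map (edge v) (nbs S v))
      disjoint (e∈ , e∈′) with ∈-map⁻ (edge v) e∈′
      ... | w , _ , refl = x∉p-x S v (edge-within⁻ v w (proj₂ (∈-filter⁻ (within? (S - v)) {xs = es} e∈)))
    ⊆-within : filter (within? (S - v)) es ++ map (edge v) (nbs S v) ⊆ filter (within? S) es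
    ⊆-within e∈ with ∈-++⁻ (filter (within? (S - v)) es) e∈
    ... | inj₁ e∈′ with ∈-filter⁻ (within? (S - v)) {xs = es} e∈′
    ...   | e∈es , a∈ , b∈ = ∈-filter⁺ (within? S) e∈es (x∈p-y⇒x∈p a∈ , x∈p-y⇒x∈p b∈)
    ⊆-within e∈ | inj₂ e∈′ with ∈-map⁻ (edge v) e∈′
    ... | w , w∈ , refl with ∈-nbs⁻ w∈
    ...   | v~w , w∈S = ∈-filter⁺ (within? S) (edge-∈ v~w) (edge-within⁺ v∈S w∈S)

  deg-remove : ∀ S x v → deg S v ≤ suc (deg (S - x) v)
  deg-remove S x v = length-⊆ {ys = x ∷ nbs (S - x) v} (nbs-unique S v) ⊆-x
    where
    ⊆-x : nbs S v ⊆ x ∷ nbs (S - x) v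
    ⊆-x {w} w∈ with w ≟ x | ∈-nbs⁻ w∈
    ... | yes w≡x | _ = here w≡x
    ... | no w≢x  | v~w , w∈S = there (∈-nbs⁺ v~w (x∈p∧x≢y⇒x∈p-y w∈S w≢x))

  deg-remove-≁ : ∀ {S x v} → ¬ (v ~ x) → deg S v ≤ deg (S - x) v
  deg-remove-≁ {S} {x} {v} v≁x = length-⊆ (nbs-unique S v) ⊆-x
    where
    ⊆-x : nbs S v ⊆ nbs (S - x) v
    ⊆-x w∈ with ∈-nbs⁻ w∈
    ... | v~w , w∈S = ∈-nbs⁺ v~w (x∈p∧x≢y⇒x∈p-y w∈S (λ { refl → v≁x v~w }))

  deg≤degree : ∀ S v → deg S v ≤ degree G v
  deg≤degree S v = length-⊆ (nbs-unique S v) (λ {w} w∈ → ∈-filter⁺ (adj? G v) (∈-allFin w) (proj₁ (∈-nbs⁻ w∈)))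

  deg<degree : ∀ {S v x} → v ~ x → x ∉ S → deg S v < degree G v
  deg<degree {S} {v} {x} v~x x∉S = length-⊆ {xs = x ∷ nbs S v}
    (All.tabulate (λ { w∈ refl → x∉S (proj₂ (∈-nbs⁻ w∈)) }) ∷ nbs-unique S v)
    (λ { (here refl) → ∈-filter⁺ (adj? G v) (∈-allFin x) v~x
       ; {w} (there w∈) → ∈-filter⁺ (adj? G v) (∈-allFin w) (proj₁ (∈-nbs⁻ w∈)) })

  degree≤deg⊤ : ∀ v → degree G v ≤ deg ⊤ v
  degree≤deg⊤ v = length-⊆ (Unique.filter⁺ (adj? G v) (Unique.allFin⁺ n))
    (λ w∈ → ∈-nbs⁺ {⊤} {v} (proj₂ (∈-filter⁻ (adj? G v) {xs = allFin n} w∈)) ∈⊤)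

  -- The potential 2m - |S| and its decrease

  -- For y = pm T, the exponent u is twice the number of edges minus the number
  -- of vertices lost from S to T.
  Gain : Subset n → ℕ → ℕ → Set
  Gain S u y = y ^ 6 * 2 ^ u * 2 ^ ∣ S ∣ ≤ 2 ^ (2 * size S)

  -- The bound 2^((2m - |S|)/6) with m = `size S`, raised to the sixth power and cleared of the
  -- negative exponent to stay within the natural numbers.
  Good : Subset n → Set
  Good S = pm S ^ 6 * 2 ^ ∣ S ∣ ≤ 2 ^ (2 * size S)

  -- Losing at most `i` vertices and at least `j` edges lowers 2m - |S| by at least 2j - i, which is
  -- at least `u`.
  gain : ∀ {S T} u i j → Good T → size T + j ≤ size S → ∣ S ∣ ≤ i + ∣ T ∣ → i + u ≤ 2 * j → Gain S u (pm T)
  gain {S} {T} u i j good size≤ ∣S∣≤ i+u≤2j = begin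
    pm T ^ 6 * 2 ^ u * 2 ^ ∣ S ∣            ≡⟨ *-assoc (pm T ^ 6) (2 ^ u) _ ⟩
    pm T ^ 6 * (2 ^ u * 2 ^ ∣ S ∣)          ≡⟨ cong (pm T ^ 6 *_) (^-distribˡ-+-* 2 u ∣ S ∣) ⟨
    pm T ^ 6 * 2 ^ (u + ∣ S ∣)              ≤⟨ *-monoʳ-≤ (pm T ^ 6) (^-monoʳ-≤ 2 exponent) ⟩
    pm T ^ 6 * 2 ^ (∣ T ∣ + 2 * j)          ≡⟨ cong (pm T ^ 6 *_) (^-distribˡ-+-* 2 ∣ T ∣ (2 * j)) ⟩
    pm T ^ 6 * (2 ^ ∣ T ∣ * 2 ^ (2 * j))    ≡⟨ *-assoc (pm T ^ 6) (2 ^ ∣ T ∣) _ ⟨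
    pm T ^ 6 * 2 ^ ∣ T ∣ * 2 ^ (2 * j)      ≤⟨ *-monoˡ-≤ (2 ^ (2 * j)) good ⟩
    2 ^ (2 * size T) * 2 ^ (2 * j)          ≡⟨ ^-distribˡ-+-* 2 (2 * size T) (2 * j) ⟨
    2 ^ (2 * size T + 2 * j)                ≡⟨ cong (2 ^_) (*-distribˡ-+ 2 (size T) j) ⟨
    2 ^ (2 * (size T + j))                  ≤⟨ ^-monoʳ-≤ 2 (*-monoʳ-≤ 2 size≤) ⟩
    2 ^ (2 * size S)                        ∎
    where
    open ≤-Reasoning
    exponent : u + ∣ S ∣ ≤ ∣ T ∣ + 2 * j
    exponent = begin
      u + ∣ S ∣         ≤⟨ +-monoʳ-≤ u ∣S∣≤ ⟩
      u + (i + ∣ T ∣)   ≡⟨ +-assoc u i _ ⟨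
      (u + i) + ∣ T ∣   ≡⟨ cong (_+ ∣ T ∣) (+-comm u i) ⟩
      (i + u) + ∣ T ∣   ≤⟨ +-monoˡ-≤ ∣ T ∣ i+u≤2j ⟩
      2 * j + ∣ T ∣     ≡⟨ +-comm (2 * j) ∣ T ∣ ⟩
      ∣ T ∣ + 2 * j     ∎

  gain-mono : ∀ {S u y z} → y ≤ z → Gain S u z → Gain S u y
  gain-mono {S} {u} y≤z = ≤-trans (*-monoˡ-≤ (2 ^ ∣ S ∣) (*-monoˡ-≤ (2 ^ u) (^-monoˡ-≤ 6 y≤z)))

  Two : Subset n → Fin n → Fin n → Fin n → Set
  Two S v a b = v ~ a × a ∈ S × v ~ b × b ∈ S × a ≢ b × nbs S v ⊆ a ∷ b ∷ []

  Two-swap : ∀ {S v a b} → Two S v a b → Two S v b a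
  Two-swap (v~a , a∈S , v~b , b∈S , a≢b , nbs⊆) = v~b , b∈S , v~a , a∈S , ≢-sym a≢b ,
    λ w∈ → case (nbs⊆ w∈)
    where
    case : ∀ {w a b : Fin n} → w ∈ₗ a ∷ b ∷ [] → w ∈ₗ b ∷ a ∷ []
    case (here w≡a) = there (here w≡a)
    case (there (here w≡b)) = here w≡b

  deg≡2⇒Two : ∀ {S v} → deg S v ≡ 2 → ∃₂ (Two S v)
  deg≡2⇒Two {S} {v} = pair (nbs S v) (nbs-unique S v) id id
    where
    pair : ∀ xs → Unique xs → xs ⊆ nbs S v → nbs S v ⊆ xs → length xs ≡ 2 → ∃₂ (Two S v)
    pair (a ∷ b ∷ []) ((a≢b ∷ []) ∷ _) xs⊆ ⊆xs refl
      with ∈-nbs⁻ (xs⊆ (here refl)) | ∈-nbs⁻ (xs⊆ (there (here refl)))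
    ... | v~a , a∈S | v~b , b∈S = a , b , v~a , a∈S , v~b , b∈S , a≢b , ⊆xs

  Two-at : ∀ {S v a} → deg S v ≡ 2 → v ~ a → a ∈ S → ∃ (Two S v a)
  Two-at {S} {v} {a} deg≡2 v~a a∈S with deg≡2⇒Two {S} {v} deg≡2
  ... | b , c , two@(_ , _ , _ , _ , _ , nbs⊆) with nbs⊆ (∈-nbs⁺ v~a a∈S)
  ...   | here refl         = c , two
  ...   | there (here refl) = b , Two-swap two

  pm-two : ∀ {S v a b} → v ∈ S → Two S v a b → pm S ≤ pm (S - v - a) + pm (S - v - b)
  pm-two {S} {v} {a} {b} v∈S (_ , _ , _ , _ , _ , nbs⊆) = begin
    pm S ≤⟨ pm-expand (a ∷ b ∷ []) v∈S nbs⊆ ⟩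
    pm (S - v - a) + (pm (S - v - b) + 0) ≡⟨ cong (pm (S - v - a) +_) (+-identityʳ _) ⟩
    pm (S - v - a) + pm (S - v - b) ∎
    where open ≤-Reasoning

  pm-one : ∀ {S v a} → v ∈ S → nbs S v ⊆ a ∷ [] → pm S ≤ pm (S - v - a)
  pm-one {S} {v} {a} v∈S nbs⊆ = ≤-trans (pm-expand (a ∷ []) v∈S nbs⊆) (≤-reflexive (+-identityʳ _))

  -- Removing `v` loses at least `d` edges, among them the one to `x`; at least `p` of the edges at
  -- `x` are still there to be lost with `x`.
  size-remove-edge : ∀ {S v x d p} → v ∈ S → x ∈ S → v ~ x → d ≤ deg S v → suc p ≤ deg S x →
    size (S - v - x) + (p + d) ≤ size S
  size-remove-edge {S} {v} {x} {d} {p} v∈S x∈S v~x d≤ 1+p≤ = begin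
    size (S - v - x) + (p + d)              ≡⟨ +-assoc (size (S - v - x)) p d ⟨
    size (S - v - x) + p + d                ≤⟨ +-monoˡ-≤ d (+-monoʳ-≤ (size (S - v - x)) p≤) ⟩
    size (S - v - x) + deg (S - v) x + d    ≤⟨ +-mono-≤ (size-remove (x∈p∧x≢y⇒x∈p-y x∈S (~⇒≢ (~-sym v~x)))) d≤ ⟩
    size (S - v) + deg S v                  ≤⟨ size-remove v∈S ⟩
    size S                                  ∎
    where
    open ≤-Reasoning
    p≤ : p ≤ deg (S - v) x
    p≤ = s≤s⁻¹ (≤-trans 1+p≤ (deg-remove S v x))

  ∣S∣≤2+∣S-v-x∣ : ∀ (S : Subset n) v x → ∣ S ∣ ≤ 2 + ∣ S - v - x ∣
  ∣S∣≤2+∣S-v-x∣ S v x = ≤-trans (∣p∣≤1+∣p-x∣ S v) (s≤s (∣p∣≤1+∣p-x∣ (S - v) x))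

  ∣S-v-x∣<∣S∣ : ∀ {S v x} → v ∈ S → x ∈ S → v ~ x → ∣ S - v - x ∣ < ∣ S ∣
  ∣S-v-x∣<∣S∣ v∈S x∈S v~x = <-trans (x∈p⇒∣p-x∣<∣p∣ (x∈p∧x≢y⇒x∈p-y x∈S (~⇒≢ (~-sym v~x)))) (x∈p⇒∣p-x∣<∣p∣ v∈S)

  gain-edge : ∀ {S v x d p} u → v ∈ S → x ∈ S → v ~ x → d ≤ deg S v → suc p ≤ deg S x →
    Good (S - v - x) → 2 + u ≤ 2 * (p + d) → Gain S u (pm (S - v - x))
  gain-edge {S} {v} {x} {d} {p} u v∈S x∈S v~x d≤ 1+p≤ good =
    gain {S} u 2 (p + d) good (size-remove-edge v∈S x∈S v~x d≤ 1+p≤) (∣S∣≤2+∣S-v-x∣ S v x)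

  -- The induction hypothesis. The vertex `z` certifies that a set is proper and remains outside it
  -- when further vertices are removed.
  Bounded : ℕ → Fin n → Set
  Bounded k z = ∀ T → ∣ T ∣ < k → z ∉ T → Good T

  ∉-removed : ∀ {S : Subset n} {z v x} → z ∉ S → z ∉ S - v - x
  ∉-removed z∉S z∈ = z∉S (x∈p-y⇒x∈p (x∈p-y⇒x∈p z∈))

  -- Branching at a vertex of degree two

  module Girth (no3 : No3Cycles G) (no4 : No4Cycles G) where

    -- Once the edge from v to x is matched, the other neighbour y of v has
    -- only y′ left.
    gain-path : ∀ {S z v x y y′ p q} u → Bounded ∣ S ∣ z → z ∉ S →
      v ∈ S → Two S v x y → Two S y v y′ → 2 ≤ deg S v → suc p ≤ deg S x → suc q ≤ deg S y′ →
      4 + u ≤ 2 * ((q + 1) + (p + 2)) → Gain S u (pm (S - v - x))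
    gain-path {S} {z} {v} {x} {y} {y′} {p} {q} u bounded z∉S v∈S
      (v~x , x∈S , v~y , y∈S , x≢y , _) (y~v , _ , y~y′ , y′∈S , v≢y′ , nbs⊆) 2≤v 1+p≤x 1+q≤y′ u≤ =
      gain-mono {S} {u} (pm-one y∈S₁ nbs₁⊆)
        (gain {S} u 4 ((q + 1) + (p + 2)) good size≤ ∣S∣≤ u≤)
      where
      open ≤-Reasoning
      S₁ T : Subset n
      S₁ = S - v - x
      T = S₁ - y - y′
      -- Since there are no 3-cycles or 4-cycles, the removal of `v` and `x` costs `y` only its edge
      -- to `v`, and costs `y′` nothing.
      y≁x : ¬ (y ~ x)
      y≁x y~x = no3 v y x (v~y , y~x , ~-sym v~x)
      y′≁v : ¬ (y′ ~ v)
      y′≁v y′~v = no3 v y y′ (v~y , y~y′ , y′~v)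
      y′≁x : ¬ (y′ ~ x)
      y′≁x y′~x = no4 v x y′ y v≢y′ x≢y (v~x , ~-sym y′~x , ~-sym y~y′ , y~v)
      y∈S₁ : y ∈ S₁
      y∈S₁ = x∈p∧x≢y⇒x∈p-y (x∈p∧x≢y⇒x∈p-y y∈S (~⇒≢ y~v)) (≢-sym x≢y)
      y′∈S₁ : y′ ∈ S₁
      y′∈S₁ = x∈p∧x≢y⇒x∈p-y (x∈p∧x≢y⇒x∈p-y y′∈S (≢-sym v≢y′)) λ { refl → y≁x y~y′ }
      nbs₁⊆ : nbs S₁ y ⊆ y′ ∷ []
      nbs₁⊆ w∈ with ∈-nbs⁻ w∈
      ... | y~w , w∈S₁ with nbs⊆ (∈-nbs⁺ y~w (x∈p-y⇒x∈p (x∈p-y⇒x∈p w∈S₁)))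
      ...   | here w≡v    = contradiction w≡v (x∈p-y⇒x≢y (x∈p-y⇒x∈p w∈S₁))
      ...   | there w∈[y′] = w∈[y′]
      1≤deg₁y : 1 ≤ deg S₁ y
      1≤deg₁y = length-⊆ {xs = y′ ∷ []} ([] ∷ []) λ { (here refl) → ∈-nbs⁺ y~y′ y′∈S₁ }
      1+q≤deg₁y′ : suc q ≤ deg S₁ y′
      1+q≤deg₁y′ = ≤-trans 1+q≤y′ (≤-trans (deg-remove-≁ {S} y′≁v) (deg-remove-≁ {S - v} y′≁x))
      size≤ : size T + ((q + 1) + (p + 2)) ≤ size S
      size≤ = begin
        size T + ((q + 1) + (p + 2)) ≡⟨ +-assoc (size T) (q + 1) (p + 2) ⟨
        size T + (q + 1) + (p + 2)   ≤⟨ +-monoˡ-≤ (p + 2) (size-remove-edge y∈S₁ y′∈S₁ y~y′ 1≤deg₁y 1+q≤deg₁y′) ⟩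
        size S₁ + (p + 2)            ≤⟨ size-remove-edge v∈S x∈S v~x 2≤v 1+p≤x ⟩
        size S                       ∎
      ∣S∣≤ : ∣ S ∣ ≤ 4 + ∣ T ∣
      ∣S∣≤ = ≤-trans (∣S∣≤2+∣S-v-x∣ S v x) (s≤s (s≤s (∣S∣≤2+∣S-v-x∣ S₁ y y′)))
      good : Good T
      good = bounded T (<-trans (∣S-v-x∣<∣S∣ y∈S₁ y′∈S₁ y~y′) (∣S-v-x∣<∣S∣ v∈S x∈S v~x))
               (∉-removed {S₁} {z} {y} {y′} (∉-removed {S} {z} {v} {x} z∉S))

    -- In either branch the other neighbour is forced, so four vertices and at least five edges go:
    -- 2m - |S| drops by at least 2·5 - 4 = 6.
    good-22 : ∀ {S z v a b} → Bounded ∣ S ∣ z → z ∉ S → (∀ w → w ∈ S → 2 ≤ deg S w) →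
      v ∈ S → Two S v a b → deg S a ≡ 2 → deg S b ≡ 2 → Good S
    good-22 {S} {z} {v} {a} {b} bounded z∉S 2≤ v∈S two@(v~a , a∈S , v~b , b∈S , _) a≡2 b≡2
      with Two-at {S} a≡2 (~-sym v~a) v∈S | Two-at {S} b≡2 (~-sym v~b) v∈S
    ... | a′ , twoA@(_ , _ , _ , a′∈S , _) | b′ , twoB@(_ , _ , _ , b′∈S , _) =
      branch-6-6 (pm S) (pm (S - v - a)) (pm (S - v - b)) (2 ^ ∣ S ∣) (2 ^ (2 * size S))
        (gain-path {S} {z} {p = 1} {q = 1} 6 bounded z∉S v∈S two twoB (2≤ v v∈S) (2≤ a a∈S) (2≤ b′ b′∈S) ≤-refl)
        (gain-path {S} {z} {p = 1} {q = 1} 6 bounded z∉S v∈S (Two-swap {S} two) twoA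
          (2≤ v v∈S) (2≤ b b∈S) (2≤ a′ a′∈S) ≤-refl)
        (pm-two v∈S two)

    good-23 : ∀ {S z v a b} → Bounded ∣ S ∣ z → z ∉ S → (∀ w → w ∈ S → 2 ≤ deg S w) →
      v ∈ S → Two S v a b → deg S v ≡ 2 → deg S a ≡ 2 → 3 ≤ deg S b → Good S
    good-23 {S} {z} {v} {a} {b} bounded z∉S 2≤ v∈S two@(v~a , a∈S , v~b , b∈S , _) v≡2 a≡2 3≤b
      with Two-at {S} a≡2 (~-sym v~a) v∈S
    ... | a′ , twoA@(_ , _ , _ , a′∈S , _) with deg S a′ in a′≡
    ...   | 0 = contradiction (subst (2 ≤_) a′≡ (2≤ a′ a′∈S)) λ ()
    ...   | 1 = contradiction (subst (2 ≤_) a′≡ (2≤ a′ a′∈S)) λ { (s≤s ()) }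
    -- Now both neighbours of `a` have degree 2, so the branching moves from `v` to `a`.
    ...   | 2 = good-22 {S} {z} bounded z∉S 2≤ a∈S twoA v≡2 a′≡
    ...   | suc (suc (suc _)) =
      branch-4-10 (pm S) (pm (S - v - a)) (pm (S - v - b)) (2 ^ ∣ S ∣) (2 ^ (2 * size S))
        -- Matching `v` with `a` removes two vertices and at least three edges: 2·3 - 2 = 4.
        (gain-edge {S} {p = 1} 4 v∈S a∈S v~a (2≤ v v∈S) (2≤ a a∈S)
          (bounded _ (∣S-v-x∣<∣S∣ v∈S a∈S v~a) (∉-removed {S} {z} {v} {a} z∉S)) ≤-refl)
        -- Matching `v` with `b` forces `a` onto `a′`. Four vertices and at least seven edges go:
        -- 2·7 - 4 = 10.
        (gain-path {S} {z} {p = 2} {q = 2} 10 bounded z∉S v∈S (Two-swap {S} two) twoA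
          (2≤ v v∈S) 3≤b (subst (3 ≤_) (sym a′≡) (s≤s (s≤s (s≤s z≤n)))) ≤-refl)
        (pm-two v∈S two)

    -- Each branch removes two vertices and at least four edges, two at `v` and two more at its
    -- partner: 2·4 - 2 = 6.
    good-33 : ∀ {S z v a b} → Bounded ∣ S ∣ z → z ∉ S →
      v ∈ S → Two S v a b → deg S v ≡ 2 → 3 ≤ deg S a → 3 ≤ deg S b → Good S
    good-33 {S} {z} {v} {a} {b} bounded z∉S v∈S two@(v~a , a∈S , v~b , b∈S , _) v≡2 3≤a 3≤b =
      branch-6-6 (pm S) (pm (S - v - a)) (pm (S - v - b)) (2 ^ ∣ S ∣) (2 ^ (2 * size S))
        (branch a∈S v~a 3≤a) (branch b∈S v~b 3≤b) (pm-two v∈S two)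
      where
      branch : ∀ {x} → x ∈ S → v ~ x → 3 ≤ deg S x → Gain S 6 (pm (S - v - x))
      branch {x} x∈S v~x 3≤x = gain-edge {S} {p = 2} 6 v∈S x∈S v~x (≤-reflexive (sym v≡2)) 3≤x
        (bounded _ (∣S-v-x∣<∣S∣ v∈S x∈S v~x) (∉-removed {S} {z} {v} {x} z∉S)) ≤-refl

    good-deg2 : ∀ {S z v} → Bounded ∣ S ∣ z → z ∉ S → (∀ w → w ∈ S → 2 ≤ deg S w) →
      v ∈ S → deg S v ≡ 2 → Good S
    good-deg2 {S} {z} {v} bounded z∉S 2≤ v∈S v≡2 with deg≡2⇒Two {S} {v} v≡2
    ... | a , b , two@(v~a , a∈S , v~b , b∈S , _) with m≤n⇒m<n∨m≡n (2≤ a a∈S) | m≤n⇒m<n∨m≡n (2≤ b b∈S)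
    ...   | inj₁ 3≤a | inj₁ 3≤b = good-33 {S} {z} bounded z∉S v∈S two v≡2 3≤a 3≤b
    ...   | inj₁ 3≤a | inj₂ 2≡b = good-23 {S} {z} bounded z∉S 2≤ v∈S (Two-swap {S} two) v≡2 (sym 2≡b) 3≤a
    ...   | inj₂ 2≡a | inj₁ 3≤b = good-23 {S} {z} bounded z∉S 2≤ v∈S two v≡2 (sym 2≡a) 3≤b
    ...   | inj₂ 2≡a | inj₂ 2≡b = good-22 {S} {z} bounded z∉S 2≤ v∈S two (sym 2≡a) (sym 2≡b)

  -- Boundary edges, empty sets and leaves

  -- The first step of the path that leaves `S` is such an edge. In a cubic graph its inner end has
  -- at most two neighbours in `S`, which is where the branching starts.
  boundary : ∀ {P : Pred (Fin n) 0ℓ} {S : Subset n} {u z} → Star (λ x y → P x × P y × x ~ y) u z → u ∈ S → z ∉ S →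
    ∃₂ λ v w → v ∈ S × w ∉ S × v ~ w
  boundary ε u∈S z∉S = contradiction u∈S z∉S
  boundary {S = S} (_◅_ {i = x} {j = y} (_ , _ , x~y) path) x∈S z∉S with y ∈? S
  ... | yes y∈S = boundary path y∈S z∉S
  ... | no y∉S  = x , y , x∈S , y∉S , x~y

  pm-empty : ∀ {S} → ¬ Nonempty S → pm S ≤ 1
  pm-empty {S} ¬ne = go es
    where
    go : ∀ ds → matchings ds S ≤ 1
    go []       = ≤-reflexive (when-yes (¬? (nonempty? S)) ¬ne)
    go (e ∷ ds) = ≤-trans (≤-reflexive (trans (cong (matchings ds S +_)
      (when-no (within? S e) (λ (a∈S , _) → ¬ne (_ , a∈S)))) (+-identityʳ _))) (go ds)

  good-≡0 : ∀ {S} → pm S ≤ 0 → Good S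
  good-≡0 {S} pm≤0 = subst (λ y → y ^ 6 * 2 ^ ∣ S ∣ ≤ 2 ^ (2 * size S)) (sym (n≤0⇒n≡0 pm≤0)) z≤n

  good-empty : ∀ {S} → ¬ Nonempty S → Good S
  good-empty {S} ¬ne = begin
    pm S ^ 6 * 2 ^ ∣ S ∣  ≤⟨ *-monoˡ-≤ (2 ^ ∣ S ∣) (^-monoˡ-≤ 6 (pm-empty ¬ne)) ⟩
    1 * 2 ^ ∣ S ∣         ≡⟨ cong (λ T → 1 * 2 ^ ∣ T ∣) (Empty-unique ¬ne) ⟩
    1 * 2 ^ ∣ ⊥ {n} ∣     ≡⟨ cong (λ k → 1 * 2 ^ k) (∣⊥∣≡0 n) ⟩
    1                     ≤⟨ ^-monoʳ-≤ 2 {0} {2 * size S} z≤n ⟩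
    2 ^ (2 * size S)      ∎
    where open ≤-Reasoning

  -- An isolated `v` cannot be matched, so the count is 0. Otherwise the only edge at `v` is forced,
  -- and losing two vertices and at least one edge does not increase 2m - |S|.
  good-leaf : ∀ {S z v} → Bounded ∣ S ∣ z → z ∉ S → v ∈ S → deg S v ≤ 1 → Good S
  good-leaf {S} {z} {v} bounded z∉S v∈S d≤1 = split (nbs S v) id id d≤1
    where
    open ≤-Reasoning
    split : ∀ xs → xs ⊆ nbs S v → nbs S v ⊆ xs → length xs ≤ 1 → Good S
    split []       _   ⊆xs _ = good-≡0 (pm-expand [] v∈S ⊆xs)
    split (a ∷ []) xs⊆ ⊆xs _ with ∈-nbs⁻ (xs⊆ (here refl))
    ... | v~a , a∈S = begin
      pm S ^ 6 * 2 ^ ∣ S ∣         ≡⟨ cong (_* 2 ^ ∣ S ∣) (*-identityʳ (pm S ^ 6)) ⟨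
      pm S ^ 6 * 2 ^ 0 * 2 ^ ∣ S ∣ ≤⟨ gain-mono {S} {0} (pm-one v∈S ⊆xs) (gain-edge {S} {p = 0} 0 v∈S a∈S v~a
            (length-⊆ {xs = a ∷ []} ([] ∷ []) xs⊆)
            (length-⊆ {xs = v ∷ []} ([] ∷ []) λ { (here refl) → ∈-nbs⁺ (~-sym v~a) v∈S })
            (bounded _ (∣S-v-x∣<∣S∣ v∈S a∈S v~a) (∉-removed {S} {z} {v} {a} z∉S)) ≤-refl) ⟩
      2 ^ (2 * size S)             ∎
    split (_ ∷ _ ∷ _) _ _ (s≤s ())

  -- The induction over proper subsets and the whole graph

  module Main (connected : Connected G) (cubic : Cubic G) (no3 : No3Cycles G) (no4 : No4Cycles G) where
    open Girth no3 no4

    good-step : ∀ {S z} → Bounded ∣ S ∣ z → z ∉ S → Good S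
    good-step {S} {z} bounded z∉S with nonempty? S
    ... | no ¬ne = good-empty ¬ne
    ... | yes (u , u∈S) with any? (λ v → (v ∈? S) ×-dec (deg S v ≤? 1))
    ...   | yes (v , v∈S , d≤1) = good-leaf {S} {z} bounded z∉S v∈S d≤1
    -- All degrees inside `S` are at least 2 now, so a vertex with a neighbour outside `S` has
    -- degree exactly 2.
    ...   | no none with boundary (connected u z _ _) u∈S z∉S
    ...     | v , w , v∈S , w∉S , v~w = good-deg2 {S} {z} bounded z∉S 2≤ v∈S
      (≤-antisym (s≤s⁻¹ (subst (deg S v <_) (cubic v) (deg<degree v~w w∉S))) (2≤ v v∈S))
      where
      2≤ : ∀ w → w ∈ S → 2 ≤ deg S w
      2≤ w w∈S = ≰⇒> (λ d≤1 → none (w , w∈S , d≤1))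

    bounded : ∀ k z → Bounded k z
    bounded (suc k) z T (s≤s ∣T∣≤k) z∉T =
      good-step {T} {z} (λ U ∣U∣< → bounded k z U (≤-trans ∣U∣< ∣T∣≤k)) z∉T

    deg⊤≡3 : ∀ v → deg ⊤ v ≡ 3
    deg⊤≡3 v = ≤-antisym (subst (deg ⊤ v ≤_) (cubic v) (deg≤degree ⊤ v))
                         (subst (_≤ deg ⊤ v) (cubic v) (degree≤deg⊤ v))

    -- The induction covers proper subsets only. After one branching at `v`, the remaining sets miss
    -- `v`; each has lost two vertices and at least five edges, whence the exponent 8 = 2·5 - 2, and
    -- the three branches contribute `3 ^ 6`.
    pm⊤-bound : Fin n → pm ⊤ ^ 6 * 2 ^ 8 * 2 ^ n ≤ 3 ^ 6 * 2 ^ (2 * size ⊤)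
    pm⊤-bound v = begin
      pm ⊤ ^ 6 * 2 ^ 8 * 2 ^ n
        ≤⟨ *-monoˡ-≤ (2 ^ n) (*-monoˡ-≤ (2 ^ 8) (^-monoˡ-≤ 6 (pm-expand (nbs ⊤ v) ∈⊤ id))) ⟩
      sum (map (λ w → pm (⊤ - v - w)) (nbs ⊤ v)) ^ 6 * 2 ^ 8 * 2 ^ n
        ≤⟨ sum-bound (λ w → pm (⊤ - v - w)) 5 (2 ^ 8) (2 ^ n) (2 ^ (2 * size ⊤)) (nbs ⊤ v) branch ⟩
      deg ⊤ v ^ 6 * 2 ^ (2 * size ⊤)
        ≡⟨ cong (λ d → d ^ 6 * 2 ^ (2 * size ⊤)) (deg⊤≡3 v) ⟩
      3 ^ 6 * 2 ^ (2 * size ⊤) ∎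
      where
      open ≤-Reasoning
      branch : ∀ {w} → w ∈ₗ nbs ⊤ v → pm (⊤ - v - w) ^ 6 * 2 ^ 8 * 2 ^ n ≤ 2 ^ (2 * size ⊤)
      branch {w} w∈ = subst (λ k → pm (⊤ - v - w) ^ 6 * 2 ^ 8 * 2 ^ k ≤ 2 ^ (2 * size ⊤)) (∣⊤∣≡n n)
        (gain-edge {⊤} {p = 2} 8 ∈⊤ ∈⊤ (proj₁ (∈-nbs⁻ w∈)) (≤-reflexive (sym (deg⊤≡3 v))) (≤-reflexive (sym (deg⊤≡3 w)))
          (bounded _ v (⊤ - v - w) ≤-refl (λ v∈ → x∉p-x ⊤ v (x∈p-y⇒x∈p v∈))) ≤-refl)

    incident≤3 : ∀ v → length (filter (incident? v) es) ≤ 3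
    incident≤3 v = begin
      length (filter (incident? v) es)
        ≤⟨ length-⊆ (Unique.filter⁺ (incident? v) edges-unique) (λ e∈ → star-⊆ ⊤ v (incident⊆star e∈)) ⟩
      length (map (edge v) (nbs ⊤ v)) ≡⟨ length-map (edge v) (nbs ⊤ v) ⟩
      deg ⊤ v                         ≡⟨ deg⊤≡3 v ⟩
      3                               ∎
      where
      open ≤-Reasoning
      incident⊆star : filter (incident? v) es ⊆ filter (inStar? ⊤ v) es
      incident⊆star e∈ with ∈-filter⁻ (incident? v) {xs = es} e∈
      ... | e∈es , v∈e = ∈-filter⁺ (inStar? ⊤ v) e∈es (v∈e , ∈⊤ , ∈⊤)

    -- Double counting, one edge at a time: each edge adds 1 at both of its ends. The inclusion in
    -- `es` is carried along because it makes the two ends distinct.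
    handshake : ∀ ds → ds ⊆ es → 2 * length ds ≤ sum (map (λ v → length (filter (incident? v) ds)) (allFin n))
    handshake []             _   = z≤n
    handshake (e@(a , b) ∷ ds) ds⊆ = begin
      2 * suc (length ds)       ≡⟨ *-suc 2 (length ds) ⟩
      2 + 2 * length ds         ≤⟨ +-mono-≤ two (handshake ds (ds⊆ ∘ there)) ⟩
      sum (map (λ v → when (incident? v e) 1) (allFin n)) +
        sum (map (λ v → length (filter (incident? v) ds)) (allFin n))
                                ≡⟨ sum-map-+ _ _ (allFin n) ⟩
      sum (map (λ v → when (incident? v e) 1 + length (filter (incident? v) ds)) (allFin n))
                                ≡⟨ cong sum (map-cong (λ v → length-filter-∷ (incident? v) e ds) (allFin n)) ⟨
      sum (map (λ v → length (filter (incident? v) (e ∷ ds))) (allFin n)) ∎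
      where
      open ≤-Reasoning
      a≢b : a ≢ b
      a≢b = ~⇒≢ (proj₂ (∈-edges⁻ (ds⊆ (here refl))))
      two : 2 ≤ sum (map (λ v → when (incident? v e) 1) (allFin n))
      two = begin
        2 ≤⟨ length-⊆ {xs = a ∷ b ∷ []} ((a≢b ∷ []) ∷ ([] ∷ [])) (λ
               { (here refl) → ∈-filter⁺ (λ v → incident? v e) (∈-allFin a) (inj₁ refl)
               ; (there (here refl)) → ∈-filter⁺ (λ v → incident? v e) (∈-allFin b) (inj₂ refl) }) ⟩
        length (filter (λ v → incident? v e) (allFin n)) ≡⟨ sum-map-1 (filter (λ v → incident? v e) (allFin n)) ⟨
        sum (map (λ _ → 1) (filter (λ v → incident? v e) (allFin n)))
          ≡⟨ sum-when (λ v → incident? v e) (λ _ → 1) (allFin n) ⟨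
        sum (map (λ v → when (incident? v e) 1) (allFin n)) ∎

    2*size⊤≤3*n : 2 * size ⊤ ≤ n * 3
    2*size⊤≤3*n = begin
      2 * size ⊤      ≤⟨ *-monoʳ-≤ 2 (length-filter (within? ⊤) es) ⟩
      2 * length es   ≤⟨ handshake es id ⟩
      sum (map (λ v → length (filter (incident? v) es)) (allFin n))
                      ≤⟨ sum-map-mono (allFin n) (λ {v} _ → incident≤3 v) ⟩
      sum (map (λ _ → 3) (allFin n))  ≡⟨ sum-const 3 (allFin n) ⟩
      length (allFin n) * 3           ≡⟨ cong (_* 3) (length-tabulate {n = n} id) ⟩
      n * 3 ∎
      where open ≤-Reasoning

    10≤n : Fin n → 10 ≤ n
    10≤n v = split (nbs ⊤ v) (nbs-unique ⊤ v) id (deg⊤≡3 v)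
      where
      open ≤-Reasoning
      N : Fin n → List (Fin n)
      N = nbs (⊤ - v)
      2≤N : ∀ a → 2 ≤ length (N a)
      2≤N a = s≤s⁻¹ (≤-trans (≤-reflexive (sym (deg⊤≡3 a))) (deg-remove ⊤ v a))
      -- A common entry differs from `v`, so it would close a 4-cycle through `v`, `a` and `b`.
      N-disjoint : ∀ {a b w} → v ~ a → v ~ b → a ≢ b → ¬ (w ∈ₗ N a × w ∈ₗ N b)
      N-disjoint {a} {b} {w} v~a v~b a≢b (w∈a , w∈b) with ∈-nbs⁻ w∈a | ∈-nbs⁻ w∈b
      ... | a~w , w∈⊤-v | b~w , _ = no4 v a w b (≢-sym (x∈p-y⇒x≢y w∈⊤-v)) a≢b (v~a , a~w , ~-sym b~w , ~-sym v~b)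
      -- A neighbour of `v` in `N a` would close a 3-cycle with `v` and `a`.
      ball-disjoint : ∀ {a w} → v ~ a → ¬ (w ∈ₗ v ∷ nbs ⊤ v × w ∈ₗ N a)
      ball-disjoint v~a (here refl , w∈) = x∉p-x ⊤ v (proj₂ (∈-nbs⁻ w∈))
      ball-disjoint v~a (there w∈v , w∈) = no3 _ _ _ (v~a , proj₁ (∈-nbs⁻ w∈) , ~-sym (proj₁ (∈-nbs⁻ {⊤} w∈v)))
      ball-unique : Unique (v ∷ nbs ⊤ v)
      ball-unique = All.tabulate (λ w∈ → ~⇒≢ (proj₁ (∈-nbs⁻ {⊤} w∈))) ∷ nbs-unique ⊤ v
      split : ∀ xs → Unique xs → xs ⊆ nbs ⊤ v → length xs ≡ 3 → 10 ≤ n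
      split (a ∷ b ∷ c ∷ []) ((a≢b ∷ a≢c ∷ []) ∷ (b≢c ∷ []) ∷ _) xs⊆ refl = begin
        4 + (2 + (2 + 2))
          ≤⟨ +-mono-≤ (s≤s (≤-reflexive (sym (deg⊤≡3 v)))) (+-mono-≤ (2≤N a) (+-mono-≤ (2≤N b) (2≤N c))) ⟩
        length (v ∷ nbs ⊤ v) + (length (N a) + (length (N b) + length (N c)))
          ≡⟨ cong (λ k → length (v ∷ nbs ⊤ v) + (length (N a) + k)) (length-++ (N b)) ⟨
        length (v ∷ nbs ⊤ v) + (length (N a) + length (N b ++ N c))
          ≡⟨ cong (length (v ∷ nbs ⊤ v) +_) (length-++ (N a)) ⟨
        length (v ∷ nbs ⊤ v) + length (N a ++ N b ++ N c)
          ≡⟨ length-++ (v ∷ nbs ⊤ v) ⟨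
        length ((v ∷ nbs ⊤ v) ++ N a ++ N b ++ N c)
          ≤⟨ length-⊆ unique (λ _ → ∈-allFin _) ⟩
        length (allFin n) ≡⟨ length-tabulate id ⟩
        n ∎
        where
        v~a : v ~ a
        v~a = proj₁ (∈-nbs⁻ {⊤} (xs⊆ (here refl)))
        v~b : v ~ b
        v~b = proj₁ (∈-nbs⁻ {⊤} (xs⊆ (there (here refl))))
        v~c : v ~ c
        v~c = proj₁ (∈-nbs⁻ {⊤} (xs⊆ (there (there (here refl)))))
        unique : Unique ((v ∷ nbs ⊤ v) ++ N a ++ N b ++ N c)
        unique = Unique.++⁺ ball-unique
          (Unique.++⁺ (nbs-unique (⊤ - v) a)
            (Unique.++⁺ (nbs-unique (⊤ - v) b) (nbs-unique (⊤ - v) c) (N-disjoint v~b v~c b≢c))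
            λ (w∈a , w∈) → [ (λ w∈b → N-disjoint v~a v~b a≢b (w∈a , w∈b)) ,
                             (λ w∈c → N-disjoint v~a v~c a≢c (w∈a , w∈c)) ] (∈-++⁻ (N b) w∈))
          λ (w∈v , w∈) → [ (λ w∈a → ball-disjoint v~a (w∈v , w∈a)) , (λ w∈bc →
            [ (λ w∈b → ball-disjoint v~b (w∈v , w∈b)) ,
              (λ w∈c → ball-disjoint v~c (w∈v , w∈c)) ] (∈-++⁻ (N b) w∈bc)) ] (∈-++⁻ (N a) w∈)

    perfmat-bound : perfmat G ^ 12 ≤ 20 ^ n
    perfmat-bound with nonempty? (⊤ {n})
    ... | no ¬ne = begin
      perfmat G ^ 12 ≤⟨ ^-monoˡ-≤ 12 (≤-trans perfmat≤pm⊤ (pm-empty ¬ne)) ⟩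
      20 ^ 0         ≤⟨ ^-monoʳ-≤ 20 {0} {n} z≤n ⟩
      20 ^ n         ∎
      where open ≤-Reasoning
    ... | yes (v , _) = ≤-trans (^-monoˡ-≤ 12 perfmat≤pm⊤)
        -- The factor to absorb is 3^12/2^16, about 8.11. It lies between (20/16)^9 and (20/16)^10,
        -- so 10 is the smallest possible threshold.
        (cancel-constants (pm ⊤) n (2 ^ 8) (3 ^ 6) 10 (10≤n v)
          (≤ᵇ⇒≤ ((3 ^ 6) ^ 2 * 16 ^ 10) ((2 ^ 8) ^ 2 * 20 ^ 10) _)
          (≤-trans (pm⊤-bound v) (*-monoʳ-≤ (3 ^ 6) (^-monoʳ-≤ 2 2*size⊤≤3*n))))

theorem6p7 : (n : ℕ) (G : SimpleGraph n) (D : SemiCircular G) →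
    Cubic G → No3Cycles G → No4Cycles G →
    let open SemiCircular D in
    (0 < n₀ → perfmat G ^ 12 ≤ 20 ^ (n ∸ n₁) * 3 ^ (3 * n₁)) ×
    (n₀ ≡ 0 → perfmat G ^ 12 ≤ 20 ^ n)
theorem6p7 n G D cubic no3 no4 = (λ _ → ≤-trans bound 20≤27) , (λ _ → bound)
  where
  open SemiCircular D
  open ≤-Reasoning
  bound : perfmat G ^ 12 ≤ 20 ^ n
  bound = Main.perfmat-bound G connected cubic no3 no4
  20≤27 : 20 ^ n ≤ 20 ^ (n ∸ n₁) * 3 ^ (3 * n₁)
  20≤27 = begin
    -- With truncated subtraction, `n` is at most `n ∸ n₁ + n₁` in any case, and an upper bound on
    -- the exponent suffices.
    20 ^ n                          ≤⟨ ^-monoʳ-≤ 20 (≤-trans (m≤n+m∸n n n₁) (≤-reflexive (+-comm n₁ (n ∸ n₁)))) ⟩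
    20 ^ (n ∸ n₁ + n₁)              ≡⟨ ^-distribˡ-+-* 20 (n ∸ n₁) n₁ ⟩
    20 ^ (n ∸ n₁) * 20 ^ n₁         ≤⟨ *-monoʳ-≤ (20 ^ (n ∸ n₁)) (^-monoˡ-≤ n₁ (≤ᵇ⇒≤ 20 (3 ^ 3) _)) ⟩
    20 ^ (n ∸ n₁) * (3 ^ 3) ^ n₁    ≡⟨ cong (20 ^ (n ∸ n₁) *_) (^-*-assoc 3 3 n₁) ⟩
    20 ^ (n ∸ n₁) * 3 ^ (3 * n₁)    ∎
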